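{- Let $a,k,n$ be integers with $a>0$ and $n\geq 3$. Let $V_{a,k,n}(\mathbb{Z})$ be the set of integer solutions $\mathbf{x}=(x_1,\dots,x_n)\in\mathbb{Z}^n$ of $$x_1^2+\cdots+x_n^2-a\,x_1x_2\cdots x_n=k,$$ and let $\Gamma_{a,n}$ be the group of maps $\mathbb{Z}^n\to\mathbb{Z}^n$ generated by: - the Vieta involutions $\mathcal{V}_{a,n,i}(x_1,\dots,x_n)=(x_1,\dots,x_{i-1},\,a x_1\cdots x_{i-1}x_{i+1}\cdots x_n-x_i,\,x_{i+1},\dots,x_n)$ for $i=1,\dots,n$; - the double sign changes $\mathcal{S}_{n,s,t}$, which replace $x_s,x_t$ by $-x_s,-x_t$ and fix the other coordinates, for $1\leq s<t\leq n$; - the permutations $\sigma(x_1,\dots,x_n)=(x_{\sigma(1)},\dots,x_{\sigma(n)})$ for $\sigma\in S_n$. Then $\Gamma_{a,n}$ acts on $V_{a,k,n}(\mathbb{Z})$, and the set $$\mathfrak{S}_0(a,k,n)\cup\mathfrak{S}_1(a,k,n)\cup\mathfrak{S}_2(a,k,n)\cup\mathfrak{S}_{>2}(a,k,n)$$ is a fundamental domain for this action, i.e. it contains exactly one point of each $\Gamma_{a,n}$-orbit in $V_{a,k,n}(\mathbb{Z})$. The four sets are as follows. $\mathfrak{S}_0(a,k,n)=\{(0,x_2,\dots,x_n)\in\mathbb{Z}^n:\ 0\leq x_2\leq\cdots\leq x_n,\ x_2^2+\cdots+x_n^2=k\}$. $\mathfrak{S}_1(a,k,n)$: - if $a=1$,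 it is $\{(-1,1,\dots,1,x_{n-1},x_n)\in\mathbb{Z}^n:\ 1\leq x_{n-1}\leq x_n,\ x_{n-1}^2+x_n^2+x_{n-1}x_n=k-n+2\}$; - if $a>1$, it is empty. $\mathfrak{S}_2(a,k,n)$: - if $a=1$, it is $\{(1,\dots,1,2,x_{n-1},x_{n-1})\in\mathbb{Z}^n:\ 2\leq x_{n-1},\ k=n+1\}\cup\{(-1,1,\dots,1,2,x_{n-1},x_n)\in\mathbb{Z}^n:\ 2\leq x_{n-1}\leq x_n,\ x_{n-1}+x_n=\sqrt{k-n-1}\}$; - if $a=2$, it is $\{(1,\dots,1,x_{n-1},x_{n-1})\in\mathbb{Z}^n:\ 1\leq x_{n-1},\ k=n-2\}\cup\{(-1,1,\dots,1,x_{n-1},x_n)\in\mathbb{Z}^n:\ 1\leq x_{n-1}\leq x_n,\ x_{n-1}+x_n=\sqrt{k-n+2}\}$; - if $a>2$, it is empty. $\mathfrak{S}_{>2}(a,k,n)$ is the union of $$\Big\{\mathbf{x}\in V_{a,k,n}(\mathbb{Z}):\ 0<x_1\leq\cdots\leq x_n\leq \tfrac{a}{2}x_1\cdots x_{n-1}\ \text{and}\ a x_1\cdots x_{n-2}>2\Big\}$$ and $$\{\mathbf{x}\in V_{a,k,n}(\mathbb{Z}):\ 0<-x_1\leq x_2\leq\cdots\leq x_n\ \text{and}\ a x_1\cdots x_{n-2}<-2\}.$$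
   Context: In the displayed tuples, "$1,\dots,1$" denotes the appropriate number of entries equal to $1$ so that the tuple lies in $\mathbb{Z}^n$.
   Formalization: For a=1 and n=3 the tuple (-1,1,…,1,2,x_{n-1},x_n) in 𝔖₂ does not exist; it is read there as (-2,x_2,x_3), since with that part empty the orbit of (-2,2,2) for k=20 would have no representative. -}

module Defs where

open import Data.Nat as ℕ using (ℕ; zero; suc; _∸_)
open import Data.Integer using (ℤ; +_; -_; _+_; _-_; _*_; _≤_; _<_; 0ℤ; 1ℤ)
open import Data.Fin as Fin using (Fin; toℕ)
open import Data.Fin.Permutation using (Permutation′; _⟨$⟩ʳ_)
open import Data.Vec using (Vec; []; _∷_; lookup; tabulate; foldr; map; _[_]≔_)
open import Data.Product using (Σ; ∃; ∃-syntax; _×_)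
open import Data.Sum using (_⊎_)
open import Relation.Nullary using (yes; no)
open import Relation.Binary.PropositionalEquality using (_≡_)
open import Relation.Binary.Construct.Closure.Equivalence using (EqClosure)

prodV : ∀ {n} → Vec ℤ n → ℤ
prodV = foldr _ _*_ 1ℤ

sumSq : ∀ {n} → Vec ℤ n → ℤ
sumSq xs = foldr _ _+_ 0ℤ (map (λ y → y * y) xs)

F : ℤ → ∀ {n} → Vec ℤ n → ℤ
F a xs = sumSq xs - a * prodV xs

V : ℤ → ℤ → (n : ℕ) → Vec ℤ n → Set
V a k n xs = F a xs ≡ k

-- 0-based coordinate access by a natural number (0 outside the range; only
-- used at in-range indices).  at x j  is  x_{j+1}  in the paper's notation.
at : ∀ {n} → Vec ℤ n → ℕ → ℤ
at []       _       = 0ℤ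
at (x ∷ xs) zero    = x
at (x ∷ xs) (suc j) = at xs j

prodUpTo : ∀ {n} → Vec ℤ n → ℕ → ℤ
prodUpTo xs zero    = 1ℤ
prodUpTo xs (suc m) = prodUpTo xs m * at xs m

prodExcept : ∀ {n} → Vec ℤ n → Fin n → ℤ
prodExcept {n} xs i = prodV (tabulate f)
  where
  f : Fin n → ℤ
  f j with j Fin.≟ i
  ... | yes _ = 1ℤ
  ... | no  _ = lookup xs j

vieta : ℤ → ∀ {n} → Fin n → Vec ℤ n → Vec ℤ n
vieta a i xs = xs [ i ]≔ (a * prodExcept xs i - lookup xs i)

signChange : ∀ {n} → Fin n → Fin n → Vec ℤ n → Vec ℤ n
signChange s t xs = (xs [ s ]≔ (- lookup xs s)) [ t ]≔ (- lookup xs t)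

permute : ∀ {n} → Permutation′ n → Vec ℤ n → Vec ℤ n
permute σ xs = tabulate (λ i → lookup xs (σ ⟨$⟩ʳ i))

data Step (a : ℤ) (n : ℕ) : Vec ℤ n → Vec ℤ n → Set where
  byVieta : ∀ i xs → Step a n xs (vieta a i xs)
  bySign  : ∀ s t → s Fin.< t → ∀ xs → Step a n xs (signChange s t xs)
  byPerm  : ∀ σ xs → Step a n xs (permute σ xs)

SameOrbit : ℤ → (n : ℕ) → Vec ℤ n → Vec ℤ n → Set
SameOrbit a n = EqClosure (Step a n)

SortedFrom : ∀ {n} → ℕ → Vec ℤ n → Set
SortedFrom {n} lo xs = ∀ j → lo ℕ.≤ j → suc j ℕ.< n → at xs j ≤ at xs (suc j)

OnesBetween : ∀ {n} → ℕ → ℕ → Vec ℤ n → Set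
OnesBetween lo hi xs = ∀ j → lo ℕ.≤ j → j ℕ.< hi → at xs j ≡ 1ℤ

module _ (a k : ℤ) (n : ℕ) (xs : Vec ℤ n) where
  private
    y z : ℤ
    y = at xs (n ∸ 2)
    z = at xs (n ∸ 1)
    nZ : ℤ
    nZ = + n

  𝔖₀ : Set
  𝔖₀ = at xs 0 ≡ 0ℤ × 0ℤ ≤ at xs 1 × SortedFrom 1 xs × sumSq xs ≡ k

  𝔖₁ : Set
  𝔖₁ = a ≡ 1ℤ × at xs 0 ≡ - 1ℤ × OnesBetween 1 (n ∸ 2) xs
       × 1ℤ ≤ y × y ≤ z × y * y + z * z + y * z ≡ k - nZ + + 2

  -- the prefix (-1,1,…,1,2) of length n-2 (for n = 3 read as (-2))
  Prefix-1-2 : Set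
  Prefix-1-2 = (n ≡ 3 × at xs 0 ≡ - + 2)
             ⊎ (4 ℕ.≤ n × at xs 0 ≡ - 1ℤ × OnesBetween 1 (n ∸ 3) xs × at xs (n ∸ 3) ≡ + 2)

  𝔖₂ : Set
  𝔖₂ = (a ≡ 1ℤ ×
          ( (OnesBetween 0 (n ∸ 3) xs × at xs (n ∸ 3) ≡ + 2 × z ≡ y × + 2 ≤ y × k ≡ nZ + 1ℤ)
          ⊎ (Prefix-1-2 × + 2 ≤ y × y ≤ z × 0ℤ ≤ y + z × (y + z) * (y + z) ≡ k - nZ - 1ℤ)))
     ⊎ (a ≡ + 2 ×
          ( (OnesBetween 0 (n ∸ 2) xs × z ≡ y × 1ℤ ≤ y × k ≡ nZ - + 2)
          ⊎ (at xs 0 ≡ - 1ℤ × OnesBetween 1 (n ∸ 2) xs × 1ℤ ≤ y × y ≤ z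
             × 0ℤ ≤ y + z × (y + z) * (y + z) ≡ k - nZ + + 2)))

  𝔖>₂ : Set
  𝔖>₂ = (V a k n xs × 0ℤ < at xs 0 × SortedFrom 0 xs
           × + 2 * z ≤ a * prodUpTo xs (n ∸ 1) × + 2 < a * prodUpTo xs (n ∸ 2))
      ⊎ (V a k n xs × 0ℤ < - at xs 0 × - at xs 0 ≤ at xs 1 × SortedFrom 1 xs
           × a * prodUpTo xs (n ∸ 2) < - + 2)

  𝔇 : Set
  𝔇 = 𝔖₀ ⊎ 𝔖₁ ⊎ 𝔖₂ ⊎ 𝔖>₂

{-# OPTIONS --safe #-}

-- Up to permutations and double sign changes a tuple is determined by the
-- multiset of the |xᵢ| together with the product of the xᵢ.  On such states a
-- Vieta move is the identity, or strictly lowers one |xᵢ|, or is the inverse of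
-- a lowering move.  Lowering moves terminate, and they are confluent: if two
-- coordinates u, v of one state can both be lowered, then a times the product
-- of the other coordinates is 1, so the moves are u ↦ v − u and v ↦ u − v, and
-- one more lowering step joins the results (unless they already agree).
-- Hence each orbit contains exactly one irreducible state.  A sorted tuple
-- with non-negative x₂, …, xₙ is determined by its state, and it is
-- irreducible iff x₁ ≤ 0 or 2xₙ ≤ a x₁⋯xₙ₋₁; splitting according to
-- a |x₁⋯xₙ₋₂| = 1, = 2, > 2 turns this into the four sets.
module Submission where

open import Defs
open import Data.Nat using (ℕ; _≤_)
open import Data.Integer using (ℤ; _<_; 0ℤ)
open import Data.Vec using (Vec)
open import Data.Product using (Σ; _×_)
open import Relation.Binary.PropositionalEquality using (_≡_)

open import Data.Fin as Fin using (Fin; zero; suc; punchIn)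
open import Data.Fin.Permutation as FP using (Permutation′; _⟨$⟩ʳ_; remove; punchIn-permute)
import Data.Fin.Properties as FinP
open import Data.Integer as ℤ using (+_; -[1+_]; ∣_∣; _⊖_; 1ℤ)
import Data.Integer.Properties as ℤP
open import Data.Integer.Tactic.RingSolver using (solve-∀)
open import Data.List as List using (List; []; _∷_; _++_)
open import Data.List.Membership.Propositional using (_∈_)
open import Data.List.Membership.Propositional.Properties using (∈-∃++)
open import Data.List.Properties using (∷-injective)
open import Data.List.Relation.Binary.Permutation.Propositional as ↭ using (_↭_; prep; swap; ↭-refl; ↭-reflexive; ↭-sym; ↭-trans; ↭⇒↭ₛ)
import Data.List.Relation.Binary.Permutation.Propositional.Properties as Perm
open import Data.List.Relation.Binary.Pointwise using (Pointwise-≡⇒≡)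
open import Data.List.Relation.Unary.Any using (here; there)
open import Data.List.Relation.Unary.Linked using (Linked; [-]; _∷_)
open import Data.List.Relation.Unary.Sorted.TotalOrder.Properties using (↗↭↗⇒≋)
open import Data.Nat as ℕ using (zero; suc; s≤s; z≤n)
open import Data.Nat.Induction using (<-wellFounded)
open import Data.Nat.ListAction using (product; sum)
open import Data.Nat.ListAction.Properties using (product-↭; sum-↭)
import Data.Nat.Properties as ℕP
import Data.Nat.Tactic.RingSolver as ℕSolver
open import Data.Product using (∃; _,_; proj₁; proj₂)
open import Data.Sum as Sum using (_⊎_; inj₁; inj₂)
open import Data.Vec as Vec using ([]; _∷_; lookup; tabulate; toList; removeAt; _[_]≔_)
import Data.Vec.Properties as VecP
open import Function using (_∘_)
open import Induction.WellFounded using (Acc; acc)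
open import Relation.Binary.Construct.Closure.ReflexiveTransitive as Star using (Star; ε; _◅_; _◅◅_)
open import Relation.Binary.Construct.Closure.Symmetric using (fwd; bwd)
open import Relation.Binary.Definitions using (tri<; tri≈; tri>)
open import Relation.Binary.PropositionalEquality using (_≢_; refl; sym; trans; cong; cong₂; subst; subst₂)
open import Relation.Nullary using (¬_; contradiction; yes; no)

-- States and their reduction

State : Set
State = List ℕ × ℤ

infix 4 _≈_
_≈_ : State → State → Set
(ls , p) ≈ (ms , q) = ls ↭ ms × p ≡ q

≈-sym : ∀ {s t} → s ≈ t → t ≈ s
≈-sym (e , e′) = ↭-sym e , sym e′

≈-trans : ∀ {s t r} → s ≈ t → t ≈ r → s ≈ r
≈-trans (e , e′) (f , f′) = ↭-trans e f , trans e′ f′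

-- A Vieta move on one coordinate, with signs chosen so that `u` and the product `Q` of the other
-- entries are non-negative. Together `positive` and `strict` say ∣A·Q - u∣ < u, so the chosen
-- absolute value drops; the new product may have either sign.
record Reduces (A : ℕ) (s t : State) : Set where
  constructor reduction
  field
    u      : ℕ
    rest   : List ℕ
  Q : ℕ
  Q = product rest
  field
    positive : 0 ℕ.< A ℕ.* Q
    strict   : A ℕ.* Q ℕ.< 2 ℕ.* u
    source   : s ≈ (u ∷ rest , + u ℤ.* + Q)
    target   : t ≈ (∣ A ℕ.* Q ⊖ u ∣ ∷ rest , (A ℕ.* Q ⊖ u) ℤ.* + Q)

reduces-resp-≈ : ∀ {A s s′ t t′} → s′ ≈ s → t′ ≈ t → Reduces A s t → Reduces A s′ t′
reduces-resp-≈ e f (reduction u ls c d src tgt) =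
  reduction u ls c d (≈-trans e src) (≈-trans f tgt)

-- Used to decide whether two lowering moves compete for the same entry of a multiset: equal heads
-- cancel, or else `ns` is what remains once both entries are removed.
∷-↭-∷ : ∀ {u v : ℕ} {ls ms} → u ∷ ls ↭ v ∷ ms →
        (u ≡ v × ls ↭ ms) ⊎ ∃ λ ns → ls ↭ v ∷ ns × ms ↭ u ∷ ns
∷-↭-∷ {u} {v} e with Perm.∈-resp-↭ (↭-sym e) (here refl)
... | here refl = inj₁ (refl , Perm.drop-∷ e)
... | there v∈ls with as , bs , refl ← ∈-∃++ v∈ls =
  inj₂ (as ++ bs , Perm.shift v as bs ,
        ↭-sym (Perm.drop-∷ (↭-trans (swap v u ↭-refl)
                 (↭-trans (prep u (↭-sym (Perm.shift v as bs))) e))))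

-- Lowering the entry v + d against the other factor d gives d - (v + d) = -v, hence the entries d
-- and v with product -dv.
diamond< : ∀ v d ns → 0 ℕ.< d → product ns ≡ 1 →
           Reduces 1 (∣ v ℕ.+ d ⊖ v ∣ ∷ v ℕ.+ d ∷ ns , (v ℕ.+ d ⊖ v) ℤ.* + (v ℕ.+ d))
                     (∣ v ⊖ (v ℕ.+ d) ∣ ∷ v ∷ ns , (v ⊖ (v ℕ.+ d)) ℤ.* + v)
diamond< v d ns 0<d e
  rewrite ℤP.⊖-≥ (ℕP.m≤m+n v d) | ℤP.⊖-≤ (ℕP.m≤m+n v d) | ℕP.m+n∸m≡n v d = reduction (v ℕ.+ d) (d ∷ ns)
    (subst (0 ℕ.<_) (sym Q≡d) 0<d)
    (subst (ℕ._< 2 ℕ.* (v ℕ.+ d)) (sym Q≡d)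
       (ℕP.<-≤-trans (ℕP.m<m+n d 0<d)
          (subst (d ℕ.+ d ℕ.≤_) (eq v d) (ℕP.m≤n+m (d ℕ.+ d) (v ℕ.+ v)))))
    (swap _ _ ↭-refl , trans (ℤP.*-comm (+ d) (+ (v ℕ.+ d))) (cong (λ i → + (v ℕ.+ d) ℤ.* + i) (sym prod≡d)))
    tgt
  where
  prod≡d : d ℕ.* product ns ≡ d
  prod≡d = trans (cong (d ℕ.*_) e) (ℕP.*-identityʳ d)
  Q≡d : 1 ℕ.* (d ℕ.* product ns) ≡ d
  Q≡d = trans (ℕP.*-identityˡ _) prod≡d
  eq : ∀ v d → v ℕ.+ v ℕ.+ (d ℕ.+ d) ≡ 2 ℕ.* (v ℕ.+ d)
  eq = ℕSolver.solve-∀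
  eqℤ : ∀ x y → ℤ.- x ℤ.* y ≡ ℤ.- y ℤ.* x
  eqℤ = solve-∀
  tgt : (∣ ℤ.- + d ∣ ∷ v ∷ ns , ℤ.- + d ℤ.* + v) ≈
        (∣ 1 ℕ.* (d ℕ.* product ns) ⊖ (v ℕ.+ d) ∣ ∷ d ∷ ns ,
         (1 ℕ.* (d ℕ.* product ns) ⊖ (v ℕ.+ d)) ℤ.* + (d ℕ.* product ns))
  tgt rewrite Q≡d | prod≡d | ℤP.⊖-≤ (ℕP.m≤n+m d v) | ℕP.m+n∸n≡m v d
            = ↭-trans (swap _ _ ↭-refl) (subst₂ (λ i j → v ∷ i ∷ ns ↭ j ∷ d ∷ ns)
                (sym (ℤP.∣-i∣≡∣i∣ (+ d))) (sym (ℤP.∣-i∣≡∣i∣ (+ v))) ↭-refl) , eqℤ (+ d) (+ v)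

-- Of the moves u ↦ v - u and v ↦ u - v, the one on the smaller coordinate gives a positive entry,
-- and its result can be lowered once more to the result of the other. For u = v both give the entry
-- 0.
diamond : ∀ u v ns → product ns ≡ 1 →
          let t = ∣ v ⊖ u ∣ ∷ v ∷ ns , (v ⊖ u) ℤ.* + v
              t′ = ∣ u ⊖ v ∣ ∷ u ∷ ns , (u ⊖ v) ℤ.* + u
          in t ≈ t′ ⊎ Reduces 1 t t′ ⊎ Reduces 1 t′ t
diamond u v ns e with ℕP.<-cmp u v
... | tri≈ _ refl _ = inj₁ (↭-refl , refl)
... | tri> _ _ v<u with d , refl ← ℕP.m≤n⇒∃[o]m+o≡n (ℕP.<⇒≤ v<u) =
  inj₂ (inj₂ (diamond< v d ns (ℕP.+-cancelˡ-< v 0 d (subst (ℕ._< v ℕ.+ d) (sym (ℕP.+-identityʳ v)) v<u)) e))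
... | tri< u<v _ _ with d , refl ← ℕP.m≤n⇒∃[o]m+o≡n (ℕP.<⇒≤ u<v) =
  inj₂ (inj₁ (diamond< u d ns (ℕP.+-cancelˡ-< u 0 d (subst (ℕ._< u ℕ.+ d) (sym (ℕP.+-identityʳ u)) u<v)) e))

-- Two coordinates can both be decreased only when a times the product of the
-- remaining ones is 1.
scale≡1 : ∀ c u v → 0 ℕ.< c ℕ.* v → c ℕ.* v ℕ.< 2 ℕ.* u → c ℕ.* u ℕ.< 2 ℕ.* v → c ≡ 1
scale≡1 1 u v _ _ _ = refl
scale≡1 (suc (suc c)) u v _ h k = contradiction
  (ℕP.≤-<-trans (ℕP.*-monoˡ-≤ v two≤) (ℕP.<-≤-trans h (ℕP.*-monoˡ-≤ u two≤)))
  (ℕP.<-asym k)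
  where
  two≤ : 2 ℕ.≤ suc (suc c)
  two≤ = s≤s (s≤s z≤n)

locally-confluent : ∀ {A s t t′} → Reduces A s t → Reduces A s t′ →
                    t ≈ t′ ⊎ Reduces A t t′ ⊎ Reduces A t′ t
locally-confluent {A} (reduction u ls c d (src , srcp) tgt) (reduction v ms c′ d′ (src′ , srcp′) tgt′)
  with ∷-↭-∷ (↭-trans (↭-sym src) src′)
... | inj₁ (refl , e) rewrite product-↭ e =
  inj₁ (≈-trans tgt (≈-trans (prep _ e , refl) (≈-sym tgt′)))
... | inj₂ (ns , e , e′) = go (product-↭ e) (product-↭ e′)
  where
  eq : ∀ A v q → A ℕ.* (v ℕ.* q) ≡ (A ℕ.* q) ℕ.* v
  eq = ℕSolver.solve-∀
  go : product ls ≡ v ℕ.* product ns → product ms ≡ u ℕ.* product ns → _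
  go Q≡ Q′≡ with scale≡1 (A ℕ.* product ns) u v
        (subst (0 ℕ.<_) (trans (cong (A ℕ.*_) Q≡) (eq A v _)) c)
        (subst (ℕ._< 2 ℕ.* u) (trans (cong (A ℕ.*_) Q≡) (eq A v _)) d)
        (subst (ℕ._< 2 ℕ.* v) (trans (cong (A ℕ.*_) Q′≡) (eq A u _)) d′)
  -- Both `A` and the product of `ns` are 1, so the entries beside `u` have product `v`, and
  -- conversely.
  ... | Aq≡1 with refl ← ℕP.m*n≡1⇒m≡1 A _ Aq≡1 | q≡1 ← ℕP.m*n≡1⇒n≡1 A _ Aq≡1 =
    Sum.map (λ h → ≈-trans t≈ (≈-trans h (≈-sym t′≈)))
      (Sum.map (reduces-resp-≈ t≈ t′≈) (reduces-resp-≈ t′≈ t≈)) (diamond u v ns q≡1)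
    where
    lsv : product ls ≡ v
    lsv = trans Q≡ (trans (cong (v ℕ.*_) q≡1) (ℕP.*-identityʳ v))
    msu : product ms ≡ u
    msu = trans Q′≡ (trans (cong (u ℕ.*_) q≡1) (ℕP.*-identityʳ u))
    t≈ : _ ≈ (∣ v ⊖ u ∣ ∷ v ∷ ns , (v ⊖ u) ℤ.* + v)
    t≈ = ≈-trans tgt (subst₂ (λ w w′ → (∣ w′ ⊖ u ∣ ∷ ls , (w′ ⊖ u) ℤ.* + w) ≈ (∣ v ⊖ u ∣ ∷ v ∷ ns , (v ⊖ u) ℤ.* + v))
            (sym lsv) (sym (trans (ℕP.*-identityˡ _) lsv)) (prep _ e , refl))
    t′≈ : _ ≈ (∣ u ⊖ v ∣ ∷ u ∷ ns , (u ⊖ v) ℤ.* + u)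
    t′≈ = ≈-trans tgt′ (subst₂ (λ w w′ → (∣ w′ ⊖ v ∣ ∷ ms , (w′ ⊖ v) ℤ.* + w) ≈ (∣ u ⊖ v ∣ ∷ u ∷ ns , (u ⊖ v) ℤ.* + u))
            (sym msu) (sym (trans (ℕP.*-identityˡ _) msu)) (prep _ e′ , refl))

-- Confluence towards an irreducible state

data Reduces* (A : ℕ) : State → State → Set where
  done : ∀ {s t} → s ≈ t → Reduces* A s t
  _then_ : ∀ {s t r} → Reduces A s t → Reduces* A t r → Reduces* A s r

Irreducible : ℕ → State → Set
Irreducible A s = ∀ t → ¬ Reduces A s t

reduces*-resp-≈ : ∀ {A s s′ t} → s′ ≈ s → Reduces* A s t → Reduces* A s′ t
reduces*-resp-≈ e (done f) = done (≈-trans e f)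
reduces*-resp-≈ e (r then rs) = reduces-resp-≈ e (↭-refl , refl) r then rs

-- Structural induction on the given sequence suffices, without an appeal to termination: by
-- `locally-confluent` the two results agree or a single step joins them, so the recursion only
-- passes to the remaining steps.
reduces*-confluent : ∀ {A s s′ t} → Irreducible A t → Reduces A s s′ → Reduces* A s t → Reduces* A s′ t
reduces*-confluent irr r (done e) = contradiction (reduces-resp-≈ (≈-sym e) (↭-refl , refl) r) (irr _)
reduces*-confluent irr r (q then qs) with locally-confluent r q
... | inj₁ e = reduces*-resp-≈ e qs
... | inj₂ (inj₁ r′) = r′ then qs
... | inj₂ (inj₂ r′) = reduces*-confluent irr r′ qs

-- Tuples and their states

∣i∣≡∣j∣⇒i≡±j : ∀ i j → ∣ i ∣ ≡ ∣ j ∣ → i ≡ j ⊎ i ≡ ℤ.- j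
∣i∣≡∣j∣⇒i≡±j (+ m)      (+ n)      e = inj₁ (cong +_ e)
∣i∣≡∣j∣⇒i≡±j (+ m)      -[1+ n ]   e = inj₂ (cong +_ e)
∣i∣≡∣j∣⇒i≡±j -[1+ m ]   (+ n)      refl = inj₂ refl
∣i∣≡∣j∣⇒i≡±j -[1+ m ]   -[1+ n ]   refl = inj₁ refl

-- Supplies the fields `positive` and `strict` from a drop in absolute value: c = 0 would give ∣-u∣
-- = u, and c ≥ 2u would give c - u ≥ u.
∣c⊖u∣<u⇒0<c<2u : ∀ c u → ∣ c ⊖ u ∣ ℕ.< u → 0 ℕ.< c × c ℕ.< 2 ℕ.* u
∣c⊖u∣<u⇒0<c<2u zero    u h = contradiction (ℕP.≤-reflexive (sym e)) (ℕP.<⇒≱ h)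
  where
  e : ∣ 0 ⊖ u ∣ ≡ u
  e = trans (cong ∣_∣ (ℤP.⊖-≤ (z≤n {u}))) (ℤP.∣-i∣≡∣i∣ (+ u))
∣c⊖u∣<u⇒0<c<2u (suc c) u h = s≤s z≤n , ℕP.≰⇒> λ 2u≤c → contradiction h (ℕP.≤⇒≯
  (subst (u ℕ.≤_) (sym (cong ∣_∣ (ℤP.⊖-≥ (ℕP.≤-trans (ℕP.m≤n*m u 2) 2u≤c))))
    (ℕP.m+n≤o⇒m≤o∸n u (subst (ℕ._≤ suc c) (cong (u ℕ.+_) (ℕP.+-identityʳ u)) 2u≤c))))

reduces-intro⁺ : ∀ A X X′ q ls {s t} → q ≡ product ls → X ℤ.+ X′ ≡ + A ℤ.* + q → ∣ X′ ∣ ℕ.< ∣ X ∣ →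
                s ≈ (∣ X ∣ ∷ ls , X ℤ.* + q) → t ≈ (∣ X′ ∣ ∷ ls , X′ ℤ.* + q) → Reduces A s t
reduces-intro⁺ A (+ u) X′ _ ls {s} {t} refl e lt src tgt =
  reduction u ls (proj₁ bounds) (proj₂ bounds) src
    (subst (λ i → t ≈ (∣ i ∣ ∷ ls , i ℤ.* + product ls)) X′≡ tgt)
  where
  c = A ℕ.* product ls
  solve : ∀ x y → y ≡ (x ℤ.+ y) ℤ.- x
  solve = solve-∀
  X′≡ : X′ ≡ c ⊖ u
  X′≡ = trans (solve (+ u) X′) (trans (cong (ℤ._- + u) (trans e (sym (ℤP.pos-* A _)))) (ℤP.m-n≡m⊖n c u))
  bounds = ∣c⊖u∣<u⇒0<c<2u c u (subst (λ i → ∣ i ∣ ℕ.< u) X′≡ lt)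
-- A negative `X` cannot be lowered while the product of the others is non-negative: `X′` is then
-- A·q + ∣X∣.
reduces-intro⁺ A -[1+ u ] X′ q ls _ e lt _ _ = contradiction
  (ℕP.≤-trans (ℕP.m≤n+m (suc u) (A ℕ.* q)) (ℕP.≤-reflexive (cong ∣_∣ (sym X′≡)))) (ℕP.<⇒≱ lt)
  where
  solve : ∀ x y → y ≡ (x ℤ.+ y) ℤ.+ ℤ.- x
  solve = solve-∀
  X′≡ : X′ ≡ + (A ℕ.* q) ℤ.+ + suc u
  X′≡ = trans (solve -[1+ u ] X′) (cong (ℤ._+ + suc u) (trans e (sym (ℤP.pos-* A q))))
-- The condition on the sum is symmetric in `X` and `X′`, so a Vieta move can be read in either
-- direction. Negating `X`, `X′` and `Q` together keeps all absolute values and both products, which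
-- settles negative `Q`.
reduces-intro : ∀ A X X′ Q ls {s t} → ∣ Q ∣ ≡ product ls → X ℤ.+ X′ ≡ + A ℤ.* Q → ∣ X′ ∣ ℕ.< ∣ X ∣ →
                s ≈ (∣ X ∣ ∷ ls , X ℤ.* Q) → t ≈ (∣ X′ ∣ ∷ ls , X′ ℤ.* Q) → Reduces A s t
reduces-intro A X X′ (+ q) ls = reduces-intro⁺ A X X′ q ls
reduces-intro A X X′ Q@(-[1+ q ]) ls {s} {t} p e lt src tgt =
  reduces-intro⁺ A (ℤ.- X) (ℤ.- X′) (suc q) ls p
    (trans (sym (ℤP.neg-distrib-+ X X′)) (trans (cong ℤ.-_ e) (ℤP.neg-distribʳ-* (+ A) Q)))
    (subst₂ ℕ._<_ (sym (ℤP.∣-i∣≡∣i∣ X′)) (sym (ℤP.∣-i∣≡∣i∣ X)) lt)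
    (negate X src) (negate X′ tgt)
  where
  neg*neg : ∀ x y → x ℤ.* y ≡ ℤ.- x ℤ.* ℤ.- y
  neg*neg = solve-∀
  negate : ∀ Y {r} → r ≈ (∣ Y ∣ ∷ ls , Y ℤ.* Q) → r ≈ (∣ ℤ.- Y ∣ ∷ ls , ℤ.- Y ℤ.* + suc q)
  negate Y (f , g) = subst (λ y → _ ↭ y ∷ ls) (sym (ℤP.∣-i∣≡∣i∣ Y)) f , trans g (neg*neg Y Q)

-- Changing a single coordinate

absList : ∀ {n} → Vec ℤ n → List ℕ
absList x = toList (Vec.map ∣_∣ x)

state : ∀ {n} → Vec ℤ n → State
state x = absList x , prodV x

∣prodV∣ : ∀ {n} (x : Vec ℤ n) → ∣ prodV x ∣ ≡ product (absList x)
∣prodV∣ []      = refl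
∣prodV∣ (h ∷ t) = trans (ℤP.abs-* h (prodV t)) (cong (∣ h ∣ ℕ.*_) (∣prodV∣ t))

absList-update : ∀ {n} (x : Vec ℤ (suc n)) i v → absList (x [ i ]≔ v) ↭ ∣ v ∣ ∷ absList (removeAt x i)
absList-update (h ∷ t)           zero    v = ↭-refl
absList-update (h ∷ t@(_ ∷ _))   (suc i) v = ↭-trans (prep _ (absList-update t i v)) (swap _ _ ↭-refl)

prodV-update : ∀ {n} (x : Vec ℤ (suc n)) i v → prodV (x [ i ]≔ v) ≡ v ℤ.* prodV (removeAt x i)
prodV-update (h ∷ t)         zero    v = refl
prodV-update (h ∷ t@(_ ∷ _)) (suc i) v =
  trans (cong (h ℤ.*_) (prodV-update t i v)) (solve h v (prodV (removeAt t i)))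
  where
  solve : ∀ a b c → a ℤ.* (b ℤ.* c) ≡ b ℤ.* (a ℤ.* c)
  solve = solve-∀

sumSq-update : ∀ {n} (x : Vec ℤ (suc n)) i v → sumSq (x [ i ]≔ v) ≡ v ℤ.* v ℤ.+ sumSq (removeAt x i)
sumSq-update (h ∷ t)         zero    v = refl
sumSq-update (h ∷ t@(_ ∷ _)) (suc i) v =
  trans (cong (λ s → h ℤ.* h ℤ.+ s) (sumSq-update t i v)) (solve (h ℤ.* h) (v ℤ.* v) (sumSq (removeAt t i)))
  where
  solve : ∀ a b c → a ℤ.+ (b ℤ.+ c) ≡ b ℤ.+ (a ℤ.+ c)
  solve = solve-∀

state-update : ∀ {n} (x : Vec ℤ (suc n)) i v →
               state (x [ i ]≔ v) ≈ (∣ v ∣ ∷ absList (removeAt x i) , v ℤ.* prodV (removeAt x i))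
state-update x i v = absList-update x i v , prodV-update x i v

-- The anonymous factor of prodExcept, given a name by unification.
factors : ∀ {n} (x : Vec ℤ n) (i : Fin n) → Σ (Fin n → ℤ) λ f → prodExcept x i ≡ prodV (tabulate f)
factors x i = _ , refl

factor-same : ∀ {n} (x : Vec ℤ n) i → proj₁ (factors x i) i ≡ 1ℤ
factor-same x i with i Fin.≟ i
... | yes _ = refl
... | no ne = contradiction refl ne

factor-other : ∀ {n} (x : Vec ℤ n) i j → j ≢ i → proj₁ (factors x i) j ≡ lookup x j
factor-other x i j j≢i with j Fin.≟ i
... | yes e = contradiction e j≢i
... | no _  = refl

-- Stated for any `f` with these two properties, so that the induction can pass to `f ∘ suc`.
prodV-tabulate-except : ∀ {n} (x : Vec ℤ (suc n)) i (f : Fin (suc n) → ℤ) → f i ≡ 1ℤ →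
                        (∀ j → j ≢ i → f j ≡ lookup x j) → prodV (tabulate f) ≡ prodV (removeAt x i)
prodV-tabulate-except (h ∷ t) zero f e o = trans
  (cong₂ ℤ._*_ e (cong prodV (trans (VecP.tabulate-cong (λ j → o (suc j) λ ())) (VecP.tabulate∘lookup t))))
  (ℤP.*-identityˡ _)
prodV-tabulate-except (h ∷ t@(_ ∷ _)) (suc i) f e o = cong₂ ℤ._*_ (o zero λ ())
  (prodV-tabulate-except t i (f ∘ suc) e (λ j j≢i → o (suc j) (j≢i ∘ FinP.suc-injective)))

prodExcept≡ : ∀ {n} (x : Vec ℤ (suc n)) i → prodExcept x i ≡ prodV (removeAt x i)
prodExcept≡ x i = prodV-tabulate-except x i (proj₁ (factors x i)) (factor-same x i) (factor-other x i)

state-lookup : ∀ {n} (x : Vec ℤ (suc n)) i →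
               state x ≈ (∣ lookup x i ∣ ∷ absList (removeAt x i) , lookup x i ℤ.* prodV (removeAt x i))
state-lookup x i = subst (λ y → state y ≈ (∣ lookup x i ∣ ∷ absList (removeAt x i) , lookup x i ℤ.* prodV (removeAt x i))) (VecP.[]≔-lookup x i) (state-update x i (lookup x i))

squares : List ℕ → ℕ
squares ls = sum (List.map (λ u → u ℕ.* u) ls)

sumSq≡squares : ∀ {n} (x : Vec ℤ n) → sumSq x ≡ + squares (absList x)
sumSq≡squares []      = refl
sumSq≡squares (h ∷ t) = cong₂ ℤ._+_ (square h) (sumSq≡squares t)
  where
  square : ∀ i → i ℤ.* i ≡ + (∣ i ∣ ℕ.* ∣ i ∣)
  square (+ m)    = sym (ℤP.pos-* m m)
  square -[1+ m ] = refl

-- The sum of squares sees only absolute values, so the form is a function of the state.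
F-cong-≈ : ∀ a {n m} {x : Vec ℤ n} {y : Vec ℤ m} → state x ≈ state y → F a x ≡ F a y
F-cong-≈ a {x = x} {y} (e , f) = cong₂ (λ s p → s ℤ.- a ℤ.* p)
  (trans (sumSq≡squares x) (trans (cong +_ (sum-↭ (Perm.map⁺ _ e))) (sym (sumSq≡squares y)))) f

-- As a polynomial in the coordinate X the form is X² - aPX + S, which is symmetric under X ↦ aP -
-- X.
F-vieta : ∀ a {n} (i : Fin n) (x : Vec ℤ n) → F a (vieta a i x) ≡ F a x
F-vieta a {suc n} i x rewrite prodExcept≡ x i = trans (expand (a ℤ.* P ℤ.- X))
  (trans (solve a X P S) (trans (sym (expand X)) (cong (F a) (VecP.[]≔-lookup x i))))
  where
  X = lookup x i
  P = prodV (removeAt x i)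
  S = sumSq (removeAt x i)
  expand : ∀ v → F a (x [ i ]≔ v) ≡ (v ℤ.* v ℤ.+ S) ℤ.- a ℤ.* (v ℤ.* P)
  expand v = cong₂ (λ s p → s ℤ.- a ℤ.* p) (sumSq-update x i v) (prodV-update x i v)
  solve : ∀ a X P S → ((a ℤ.* P ℤ.- X) ℤ.* (a ℤ.* P ℤ.- X) ℤ.+ S) ℤ.- a ℤ.* ((a ℤ.* P ℤ.- X) ℤ.* P)
                      ≡ (X ℤ.* X ℤ.+ S) ℤ.- a ℤ.* (X ℤ.* P)
  solve = solve-∀

-- Permutations and sign changes

tabulate-punchIn : ∀ {A : Set} {n} (f : Fin (suc n) → A) i →
                   f i ∷ toList (tabulate (f ∘ punchIn i)) ↭ toList (tabulate f)
tabulate-punchIn f zero = ↭-refl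
tabulate-punchIn {n = suc n} f (suc i) =
  ↭-trans (swap _ _ ↭-refl) (prep _ (tabulate-punchIn (f ∘ suc) i))

-- The first entry is the value of `f` at the image of 0; the others are `f` with that index punched
-- out, rearranged by `remove zero σ`.
tabulate-permute : ∀ {A : Set} {n} (f : Fin n → A) (σ : Permutation′ n) →
                   toList (tabulate (f ∘ (σ ⟨$⟩ʳ_))) ↭ toList (tabulate f)
tabulate-permute {n = zero}  f σ = ↭-refl
tabulate-permute {n = suc n} f σ = ↭-trans
  (prep _ (↭-trans (↭-reflexive (cong toList (VecP.tabulate-cong λ j → cong f (punchIn-permute σ zero j))))
    (tabulate-permute (f ∘ punchIn (σ ⟨$⟩ʳ zero)) (remove zero σ))))
  (tabulate-punchIn f (σ ⟨$⟩ʳ zero))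

permute-↭ : ∀ {n} (σ : Permutation′ n) (x : Vec ℤ n) → toList (permute σ x) ↭ toList x
permute-↭ σ x = subst (λ y → toList (permute σ x) ↭ toList y) (VecP.tabulate∘lookup x)
  (tabulate-permute (lookup x) σ)

prodℤ : List ℤ → ℤ
prodℤ = List.foldr ℤ._*_ 1ℤ

prodℤ-↭ : ∀ {xs ys} → xs ↭ ys → prodℤ xs ≡ prodℤ ys
prodℤ-↭ ↭.refl         = refl
prodℤ-↭ (prep x e)         = cong (x ℤ.*_) (prodℤ-↭ e)
prodℤ-↭ (swap {xs} {ys} x y e) = trans (cong (λ p → x ℤ.* (y ℤ.* p)) (prodℤ-↭ e)) (solve x y (prodℤ ys))
  where
  solve : ∀ a b c → a ℤ.* (b ℤ.* c) ≡ b ℤ.* (a ℤ.* c)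
  solve = solve-∀
prodℤ-↭ (↭.trans e f) = trans (prodℤ-↭ e) (prodℤ-↭ f)

prodV≡prodℤ : ∀ {n} (x : Vec ℤ n) → prodV x ≡ prodℤ (toList x)
prodV≡prodℤ []      = refl
prodV≡prodℤ (h ∷ t) = cong (h ℤ.*_) (prodV≡prodℤ t)

↭⇒≈ : ∀ {n} {x y : Vec ℤ n} → toList x ↭ toList y → state x ≈ state y
↭⇒≈ {x = x} {y} e =
  subst₂ _↭_ (sym (VecP.toList-map ∣_∣ x)) (sym (VecP.toList-map ∣_∣ y)) (Perm.map⁺ ∣_∣ e) ,
  trans (prodV≡prodℤ x) (trans (prodℤ-↭ e) (sym (prodV≡prodℤ y)))

absList-negate : ∀ {n} (x : Vec ℤ n) i → absList (x [ i ]≔ (ℤ.- lookup x i)) ≡ absList x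
absList-negate (h ∷ t) zero    = cong (_∷ absList t) (ℤP.∣-i∣≡∣i∣ h)
absList-negate (h ∷ t) (suc i) = cong (∣ h ∣ ∷_) (absList-negate t i)

prodV-negate : ∀ {n} (x : Vec ℤ n) i → prodV (x [ i ]≔ (ℤ.- lookup x i)) ≡ ℤ.- prodV x
prodV-negate (h ∷ t) zero    = sym (ℤP.neg-distribˡ-* h (prodV t))
prodV-negate (h ∷ t) (suc i) = trans (cong (h ℤ.*_) (prodV-negate t i)) (sym (ℤP.neg-distribʳ-* h (prodV t)))

-- `signChange` reads both entries from the original tuple. Since the first update leaves position
-- `t` alone, it is a composite of two single negations, each of which reverses the sign of the
-- product.
signChange≡ : ∀ {n} {s t : Fin n} → s ≢ t → ∀ x → let y = x [ s ]≔ (ℤ.- lookup x s) in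
              signChange s t x ≡ y [ t ]≔ (ℤ.- lookup y t)
signChange≡ {s = s} {t} s≢t x = cong (λ v → (x [ s ]≔ (ℤ.- lookup x s)) [ t ]≔ (ℤ.- v))
  (sym (VecP.lookup∘update′ (s≢t ∘ sym) x _))

signChange-≈ : ∀ {n} {s t : Fin n} → s Fin.< t → ∀ x → state (signChange s t x) ≈ state x
signChange-≈ {s = s} {t} s<t x rewrite signChange≡ (FinP.<⇒≢ s<t) x =
  ↭-reflexive (trans (absList-negate y t) (absList-negate x s)) ,
  trans (prodV-negate y t) (trans (cong ℤ.-_ (prodV-negate x s)) (ℤP.neg-involutive (prodV x)))
  where y = x [ s ]≔ (ℤ.- lookup x s)

-- Effect of the generators on states and on the form

step-state : ∀ A {n} → 0 ℕ.< A → {x y : Vec ℤ n} → Step (+ A) n x y →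
             state x ≈ state y ⊎ Reduces A (state x) (state y) ⊎ Reduces A (state y) (state x)
step-state A 0<A (bySign s t s<t x) = inj₁ (≈-sym (signChange-≈ s<t x))
step-state A 0<A (byPerm σ x) = inj₁ (≈-sym (↭⇒≈ {x = permute σ x} {x} (permute-↭ σ x)))
step-state A {suc n} 0<A (byVieta i x) rewrite prodExcept≡ x i = go (ℕP.<-cmp ∣ X ∣ ∣ X′ ∣)
  where
  X = lookup x i
  Q = prodV (removeAt x i)
  X′ = + A ℤ.* Q ℤ.- X
  y = x [ i ]≔ X′
  Q≡ = ∣prodV∣ (removeAt x i)
  solve₁ : ∀ x c → x ℤ.+ (c ℤ.- x) ≡ c
  solve₁ = solve-∀
  solve₂ : ∀ x c → (c ℤ.- x) ℤ.+ x ≡ c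
  solve₂ = solve-∀
  go : _ → state x ≈ state y ⊎ Reduces A (state x) (state y) ⊎ Reduces A (state y) (state x)
  go (tri> _ _ lt) = inj₂ (inj₁ (reduces-intro A X X′ Q _ Q≡ (solve₁ X _) lt
                       (state-lookup x i) (state-update x i X′)))
  go (tri< lt _ _) = inj₂ (inj₂ (reduces-intro A X′ X Q _ Q≡ (solve₂ X _) lt
                       (state-update x i X′) (state-lookup x i)))
  go (tri≈ _ e _) = inj₁ (≈-trans (state-lookup x i) (≈-trans
      (↭-reflexive (cong (_∷ absList (removeAt x i)) e) , same (∣i∣≡∣j∣⇒i≡±j X X′ e))
      (≈-sym (state-update x i X′))))
    where
    same : X ≡ X′ ⊎ X ≡ ℤ.- X′ → X ℤ.* Q ≡ X′ ℤ.* Q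
    same (inj₁ e) = cong (ℤ._* Q) e
    -- X = -X′ forces A·Q = X + X′ = 0; as A > 0, `Q` is 0 and both products vanish.
    same (inj₂ e) with ℤP.i*j≡0⇒i≡0∨j≡0 (+ A)
                         (trans (sym (solve₁ X _)) (trans (cong (ℤ._+ X′) e) (ℤP.+-inverseˡ X′)))
    ... | inj₁ A≡0 = contradiction (subst (0 ℕ.<_) (ℤP.+-injective A≡0) 0<A) ℕP.n≮0
    ... | inj₂ Q≡0 = trans (cong (X ℤ.*_) Q≡0) (trans (ℤP.*-zeroʳ X) (sym
                       (trans (cong (X′ ℤ.*_) Q≡0) (ℤP.*-zeroʳ X′))))

step-V : ∀ {a n} {x y : Vec ℤ n} → Step a n x y → F a y ≡ F a x
step-V {a} (byVieta i x) = F-vieta a i x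
step-V {a} (bySign s t s<t x) = F-cong-≈ a {x = signChange s t x} {x} (signChange-≈ s<t x)
step-V {a} (byPerm σ x) = F-cong-≈ a {x = permute σ x} {x} (↭⇒≈ {x = permute σ x} {x} (permute-↭ σ x))

-- Canonical tuples

prodUpTo-∷ : ∀ {n} h (t : Vec ℤ n) m → prodUpTo (h ∷ t) (suc m) ≡ h ℤ.* prodUpTo t m
prodUpTo-∷ h t zero    = ℤP.*-comm 1ℤ h
prodUpTo-∷ h t (suc m) = trans (cong (ℤ._* at t m) (prodUpTo-∷ h t m)) (ℤP.*-assoc h _ _)

prodV≡prodUpTo : ∀ {n} (x : Vec ℤ n) → prodV x ≡ prodUpTo x n
prodV≡prodUpTo []      = refl
prodV≡prodUpTo {suc n} (h ∷ t) = trans (cong (h ℤ.*_) (prodV≡prodUpTo t)) (sym (prodUpTo-∷ h t n))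

prodV-removeLast : ∀ {k} (x : Vec ℤ (suc k)) → prodV (removeAt x (Fin.fromℕ k)) ≡ prodUpTo x k
prodV-removeLast {zero}  (h ∷ [])        = refl
prodV-removeLast {suc k} (h ∷ t@(_ ∷ _)) = trans (cong (h ℤ.*_) (prodV-removeLast t)) (sym (prodUpTo-∷ h t k))

lookup-last : ∀ {k} (x : Vec ℤ (suc k)) → lookup x (Fin.fromℕ k) ≡ at x k
lookup-last {zero}  (h ∷ [])        = refl
lookup-last {suc k} (h ∷ t@(_ ∷ _)) = lookup-last t

Sorted : List ℕ → Set
Sorted = Linked ℕ._≤_

-- The shape that permutations and double sign changes can always reach: a single free sign, carried
-- by an entry of least absolute value.
NormalShape : ∀ {m} → Vec ℤ (suc m) → Set
NormalShape {m} (h ∷ t) = Σ (Vec ℕ m) λ us → t ≡ Vec.map +_ us × Sorted (∣ h ∣ ∷ toList us)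

absList-map+ : ∀ {m} (us : Vec ℕ m) → absList (Vec.map +_ us) ≡ toList us
absList-map+ []       = refl
absList-map+ (u ∷ us) = cong (u ∷_) (absList-map+ us)

prodV-map+ : ∀ {m} (us : Vec ℕ m) → prodV (Vec.map +_ us) ≡ + product (toList us)
prodV-map+ []       = refl
prodV-map+ (u ∷ us) = trans (cong (+ u ℤ.*_) (prodV-map+ us)) (sym (ℤP.pos-* u _))

toList-injective : ∀ {m} (us vs : Vec ℕ m) → toList us ≡ toList vs → us ≡ vs
toList-injective []       []       e = refl
toList-injective (u ∷ us) (v ∷ vs) e with refl , e′ ← ∷-injective e = cong (u ∷_) (toList-injective us vs e′)

-- Some entry of `ls` is 0, and `b` is bounded by it. This covers the case where the product cannot
-- reveal the sign of the head.
sorted-product≡0 : ∀ b ls → Sorted (b ∷ ls) → product ls ≡ 0 → b ≡ 0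
sorted-product≡0 b (u ∷ ls) (b≤u ∷ s) e with ℕP.m*n≡0⇒m≡0∨n≡0 u e
... | inj₁ refl = ℕP.n≤0⇒n≡0 b≤u
... | inj₂ e′ with refl ← sorted-product≡0 u ls s e′ = ℕP.n≤0⇒n≡0 b≤u

sorted-unique : ∀ {ls ms} → Sorted ls → Sorted ms → ls ↭ ms → ls ≡ ms
sorted-unique s s′ e = Pointwise-≡⇒≡ (↗↭↗⇒≋ ℕP.≤-totalOrder s s′ (↭⇒↭ₛ e))

-- Sorting makes the absolute values agree in order. The sign of the head is then read off the total
-- product, unless the tail has product 0; in that case the head is 0 as well.
normalShape-unique : ∀ {m} (x y : Vec ℤ (suc m)) → NormalShape x → NormalShape y → state x ≈ state y → x ≡ y
normalShape-unique (h ∷ _) (g ∷ _) (us , refl , s) (vs , refl , s′) (e , p)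
  rewrite absList-map+ us | absList-map+ vs
  with ∣h∣≡∣g∣ , us≡vs ← ∷-injective (sorted-unique s s′ e)
  with refl ← toList-injective us vs us≡vs
  rewrite prodV-map+ us = cong (_∷ Vec.map +_ us) (heads (product (toList us)) refl p)
  where
  heads : ∀ q → product (toList us) ≡ q → h ℤ.* + q ≡ g ℤ.* + q → h ≡ g
  heads zero    q≡0 _ = trans (ℤP.∣i∣≡0⇒i≡0 ∣h∣≡0) (sym (ℤP.∣i∣≡0⇒i≡0 (trans (sym ∣h∣≡∣g∣) ∣h∣≡0)))
    where ∣h∣≡0 = sorted-product≡0 ∣ h ∣ (toList us) s q≡0
  heads (suc q) _ e = ℤP.*-cancelʳ-≡ h g (+ suc q) e

SortedFrom-tail : ∀ {n lo h} {t : Vec ℤ n} → SortedFrom (suc lo) (h ∷ t) → SortedFrom lo t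
SortedFrom-tail s j lo≤j j<n = s (suc j) (s≤s lo≤j) (s≤s j<n)

ascending⇒sorted : ∀ {m} b (t : Vec ℤ (suc m)) → + b ℤ.≤ at t 0 → SortedFrom 0 t →
                   Σ (Vec ℕ (suc m)) λ us → t ≡ Vec.map +_ us × Sorted (b ∷ toList us)
ascending⇒sorted b (+ c ∷ [])    (ℤ.+≤+ b≤c) s = c ∷ [] , refl , b≤c ∷ [-]
ascending⇒sorted b (+ c ∷ t@(_ ∷ _)) (ℤ.+≤+ b≤c) s
  with us , e , l ← ascending⇒sorted c t (s 0 z≤n (s≤s (s≤s z≤n))) (SortedFrom-tail {h = + c} λ j _ → s j z≤n) =
  c ∷ us , cong (+ c ∷_) e , b≤c ∷ l

sorted⇒ascending : ∀ {m} (us : Vec ℕ m) → Sorted (toList us) → SortedFrom 0 (Vec.map +_ us)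
sorted⇒ascending (u ∷ v ∷ us) (u≤v ∷ s) zero    _ _ = ℤ.+≤+ u≤v
sorted⇒ascending (u ∷ v ∷ us) (u≤v ∷ s) (suc j) _ (s≤s j<n) = sorted⇒ascending (v ∷ us) s j z≤n j<n
sorted⇒ascending []           _ _ _ ()
sorted⇒ascending (u ∷ [])     _ _ _ (s≤s ())

SortedFrom-∷ : ∀ {n lo h} {t : Vec ℤ n} → SortedFrom lo t → SortedFrom (suc lo) (h ∷ t)
SortedFrom-∷ s (suc j) (s≤s lo≤j) (s≤s j<n) = s j lo≤j j<n

last-max : ∀ {k} (us : Vec ℕ (suc k)) {u} → Sorted (toList us) → u ∈ toList us → + u ℤ.≤ at (Vec.map +_ us) k
last-max (v ∷ [])     s         (here refl) = ℤP.≤-refl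
last-max (v ∷ w ∷ us) (v≤w ∷ s) (here refl) = ℤP.≤-trans (ℤ.+≤+ v≤w) (last-max (w ∷ us) s (here refl))
last-max (v ∷ w ∷ us) (v≤w ∷ s) (there u∈)  = last-max (w ∷ us) s u∈

-- The union of the four sets, minus the equation, sorted by the sign of x₁.
Canonical : ℤ → ∀ {n} → Vec ℤ n → Set
Canonical a {n} x =
    (at x 0 ≡ 0ℤ × 0ℤ ℤ.≤ at x 1 × SortedFrom 1 x)
  ⊎ (0ℤ ℤ.< ℤ.- at x 0 × ℤ.- at x 0 ℤ.≤ at x 1 × SortedFrom 1 x)
  ⊎ (0ℤ ℤ.< at x 0 × SortedFrom 0 x × + 2 ℤ.* at x (n ℕ.∸ 1) ℤ.≤ a ℤ.* prodUpTo x (n ℕ.∸ 1))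

-- Canonical tuples are irreducible

canonical⇒normalShape : ∀ a {m} (x : Vec ℤ (suc (suc m))) → Canonical a x → NormalShape x
canonical⇒normalShape a (_ ∷ t)        (inj₁ (refl , b , s))           = ascending⇒sorted 0 t b (SortedFrom-tail s)
canonical⇒normalShape a (-[1+ p ] ∷ t) (inj₂ (inj₁ (_ , b , s)))       = ascending⇒sorted (suc p) t b (SortedFrom-tail s)
canonical⇒normalShape a (+ zero ∷ t)   (inj₂ (inj₁ (ℤ.+<+ () , _)))
canonical⇒normalShape a (+ p ∷ t)      (inj₂ (inj₂ (_ , s , _)))       =
  ascending⇒sorted p t (s 0 z≤n (s≤s (s≤s z≤n))) (SortedFrom-tail {h = + p} λ j _ → s j z≤n)

-- `strict` forces u > 0 and `positive` forces Q > 0. Tuples with a head at most 0 and non-negative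
-- other entries are thereby irreducible.
reducible⇒0<prodV : ∀ {A s t} → Reduces A s t → 0ℤ ℤ.< proj₂ s
reducible⇒0<prodV {A} (reduction zero    rest c () (_ , p) _)
reducible⇒0<prodV {A} (reduction (suc u) rest c d (_ , p) _) = go (product rest) refl c p
  where
  go : ∀ q → product rest ≡ q → 0 ℕ.< A ℕ.* q → _ ≡ + suc u ℤ.* + q → 0ℤ ℤ.< _
  go zero    _ c _ = contradiction (subst (0 ℕ.<_) (ℕP.*-zeroʳ A) c) ℕP.n≮0
  go (suc q) _ _ p = subst (0ℤ ℤ.<_) (sym p) (ℤ.+<+ (s≤s z≤n))

-- The chain 2u² ≤ 2z² ≤ cz. It carries the size bound from the largest entry `z` to any other entry
-- `u`, because cz will be a times the product of all entries.
bound-squared : ∀ {u z c w} → + u ℤ.≤ z → + 2 ℤ.* z ℤ.≤ c → c ℤ.* z ≡ + w → 2 ℕ.* u ℕ.* u ℕ.≤ w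
bound-squared {u} {+ v} {c} {w} (ℤ.+≤+ u≤v) b e = ℕP.≤-trans (ℕP.*-mono-≤ (ℕP.*-monoʳ-≤ 2 u≤v) u≤v)
  (ℤP.drop‿+≤+ (subst₂ ℤ._≤_ (trans (cong (ℤ._* + v) (sym (ℤP.pos-* 2 v))) (sym (ℤP.pos-* (2 ℕ.* v) v))) e
    (ℤP.*-monoʳ-≤-nonNeg (+ v) b)))

-- A head at most 0 excludes a positive product. For a positive head, lowering `u` would need A·Q·u
-- < 2u², against `bound-squared`; hence a bound on the last coordinate alone controls all of them.
canonical⇒irreducible : ∀ {A m} (x : Vec ℤ (suc (suc m))) → Canonical (+ A) x → Irreducible A (state x)
canonical⇒irreducible (_ ∷ t) (inj₁ (refl , _)) _ r = ℤP.<-irrefl refl (reducible⇒0<prodV r)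
canonical⇒irreducible {A} x@(-[1+ p ] ∷ t) c@(inj₂ (inj₁ _)) _ r
  with us , refl , _ ← canonical⇒normalShape (+ A) x c =
  nonpos (product (toList us)) (subst (λ q → 0ℤ ℤ.< -[1+ p ] ℤ.* q) (prodV-map+ us) (reducible⇒0<prodV r))
  where
  nonpos : ∀ q → ¬ 0ℤ ℤ.< -[1+ p ] ℤ.* + q
  nonpos zero    lt = ℤP.<-irrefl (sym (ℤP.*-zeroʳ -[1+ p ])) lt
  nonpos (suc q) ()
canonical⇒irreducible (+ zero ∷ t)   (inj₂ (inj₁ (ℤ.+<+ () , _)))
canonical⇒irreducible {A} {m} x@(+ p ∷ t) c@(inj₂ (inj₂ (_ , _ , bound))) _ r@(reduction u rest pos strict (src , prod) _)
  with us , refl , s ← canonical⇒normalShape (+ A) x c = contradiction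
    (bound-squared u≤z bound aP)
    (ℕP.<⇒≱ (ℕP.*-monoˡ-< u {{ℕ.>-nonZero 0<u}} strict))
  where
  Q = product rest
  0<u : 0 ℕ.< u
  0<u = ℕP.*-cancelˡ-< 2 0 u (ℕP.≤-<-trans z≤n strict)
  u≤z : + u ℤ.≤ at x (suc m)
  u≤z = last-max (p ∷ us) s (subst (u ∈_) (cong (p ∷_) (absList-map+ us)) (Perm.∈-resp-↭ (↭-sym src) (here refl)))
  solve₁ : ∀ a q u → a ℤ.* (u ℤ.* q) ≡ (a ℤ.* q) ℤ.* u
  solve₁ = solve-∀
  aP : + A ℤ.* prodUpTo x (suc m) ℤ.* at x (suc m) ≡ + (A ℕ.* Q ℕ.* u)
  aP = trans (ℤP.*-assoc (+ A) _ _) (trans (cong (+ A ℤ.*_) (trans (sym (prodV≡prodUpTo x)) prod))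
         (trans (solve₁ (+ A) (+ Q) (+ u)) (trans (cong (ℤ._* + u) (sym (ℤP.pos-* A Q))) (sym (ℤP.pos-* (A ℕ.* Q) u)))))

-- Uniqueness of the canonical tuple in its orbit

step-reduces* : ∀ A {n} → 0 ℕ.< A → {x y : Vec ℤ n} {s : State} → Irreducible A s → Step (+ A) n x y →
                (Reduces* A (state x) s → Reduces* A (state y) s) × (Reduces* A (state y) s → Reduces* A (state x) s)
step-reduces* A 0<A {x} {y} irr st with step-state A 0<A st
... | inj₁ e         = reduces*-resp-≈ (≈-sym e) , reduces*-resp-≈ e
-- Against the lowering step `r`, prepend it; along `r`, use confluence. Reaching a fixed
-- irreducible state is thus an orbit invariant.
... | inj₂ (inj₁ r) = reduces*-confluent irr r , (r then_)
... | inj₂ (inj₂ r) = (r then_) , reduces*-confluent irr r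

orbit-reduces* : ∀ A {n} → 0 ℕ.< A → {x y : Vec ℤ n} → Irreducible A (state y) →
                 SameOrbit (+ A) n x y → Reduces* A (state x) (state y)
orbit-reduces* A 0<A irr ε            = done (↭-refl , refl)
orbit-reduces* A 0<A irr (fwd s ◅ ss) = proj₂ (step-reduces* A 0<A irr s) (orbit-reduces* A 0<A irr ss)
orbit-reduces* A 0<A irr (bwd s ◅ ss) = proj₁ (step-reduces* A 0<A irr s) (orbit-reduces* A 0<A irr ss)

canonical-unique : ∀ A {m} → 0 ℕ.< A → (x y : Vec ℤ (suc (suc m))) → Canonical (+ A) x → Canonical (+ A) y →
                   SameOrbit (+ A) (suc (suc m)) x y → x ≡ y
canonical-unique A 0<A x y c d o with orbit-reduces* A 0<A (canonical⇒irreducible y d) o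
... | done e  = normalShape-unique x y (canonical⇒normalShape (+ A) x c) (canonical⇒normalShape (+ A) y d) e
... | r then _ = contradiction r (canonical⇒irreducible x c _)

-- Reduction to canonical tuples

infix 4 _⇝_
-- A pointwise version of `permute`, which composes and extends without comparing tabulated vectors;
-- `⇝⇒permute` converts it back.
record _⇝_ {n} (x y : Vec ℤ n) : Set where
  constructor _via_
  field
    permutation : Permutation′ n
    rearranged  : ∀ i → lookup y i ≡ lookup x (permutation ⟨$⟩ʳ i)

⇝-refl : ∀ {n} {x : Vec ℤ n} → x ⇝ x
⇝-refl = FP.id via λ _ → refl

⇝-trans : ∀ {n} {x y z : Vec ℤ n} → x ⇝ y → y ⇝ z → x ⇝ z
⇝-trans (σ via e) (τ via f) = (τ FP.∘ₚ σ) via λ i → trans (f i) (e (τ ⟨$⟩ʳ i))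

⇝-prep : ∀ {n} h {x y : Vec ℤ n} → x ⇝ y → h ∷ x ⇝ h ∷ y
⇝-prep h (σ via e) = FP.lift₀ σ via λ { zero → refl ; (suc i) → e i }

⇝-swap : ∀ {n} g h {x : Vec ℤ n} → g ∷ h ∷ x ⇝ h ∷ g ∷ x
⇝-swap g h = FP.swap FP.id via λ { zero → refl ; (suc zero) → refl ; (suc (suc i)) → refl }

⇝⇒permute : ∀ {n} {x y : Vec ℤ n} → x ⇝ y → Σ (Permutation′ n) λ σ → permute σ x ≡ y
⇝⇒permute {y = y} (σ via e) = σ , trans (VecP.tabulate-cong (λ i → sym (e i))) (VecP.tabulate∘lookup y)

-- One round of insertion sort on absolute values; `b` stands for the entry already placed on the
-- left.
insert : ∀ {n} b h (x : Vec ℤ n) → b ℕ.≤ ∣ h ∣ → Sorted (b ∷ absList x) →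
         Σ (Vec ℤ (suc n)) λ y → h ∷ x ⇝ y × Sorted (b ∷ absList y)
insert b h []      b≤h [-] = h ∷ [] , ⇝-refl , b≤h ∷ [-]
insert b h (g ∷ x) b≤h (b≤g ∷ s) with ℕP.≤-total ∣ h ∣ ∣ g ∣
... | inj₁ h≤g = h ∷ g ∷ x , ⇝-refl , b≤h ∷ h≤g ∷ s
... | inj₂ g≤h with y , p , s′ ← insert ∣ g ∣ h x g≤h s =
  g ∷ y , ⇝-trans (⇝-swap h g) (⇝-prep g p) , b≤g ∷ s′

sort : ∀ {n} (x : Vec ℤ n) → Σ (Vec ℤ n) λ y → x ⇝ y × Sorted (0 ∷ absList y)
sort []      = [] , ⇝-refl , [-]
sort (h ∷ x) with y , p , s ← sort x with z , q , s′ ← insert 0 h y z≤n s =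
  z , ⇝-trans (⇝-prep h p) q , s′

-- Collecting the signs in the head

Flip : ∀ {m} → Vec ℤ (suc m) → Vec ℤ (suc m) → Set
Flip {m} x y = Σ (Fin m) λ j → y ≡ signChange zero (suc j) x

-- Every `Flip` involves the head, so a new entry has to go behind it for flips to carry over to the
-- longer tuple.
insertSecond : ∀ {m} → ℤ → Vec ℤ (suc m) → Vec ℤ (suc (suc m))
insertSecond g (h ∷ t) = h ∷ g ∷ t

flip-insertSecond : ∀ {m} g {x y : Vec ℤ (suc m)} → Flip x y → Flip (insertSecond g x) (insertSecond g y)
flip-insertSecond g {_ ∷ _} (j , e) = suc j , cong (insertSecond g) e

-- Each negative entry of the tail is made positive by a double sign change shared with the head;
-- only the sign of the head depends on how many there were.
normalizeSigns : ∀ {m} h (t : Vec ℤ m) → Σ ℤ λ h′ → ∣ h′ ∣ ≡ ∣ h ∣ ×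
                 Star Flip (h ∷ t) (h′ ∷ Vec.map +_ (Vec.map ∣_∣ t))
normalizeSigns h []      = h , refl , ε
normalizeSigns h (g ∷ t) with h′ , e , p ← normalizeSigns h t | g
... | + n      = h′ , e , Star.gmap (insertSecond (+ n)) (flip-insertSecond (+ n)) p
... | -[1+ n ] = ℤ.- h′ , trans (ℤP.∣-i∣≡∣i∣ h′) e ,
  Star.gmap (insertSecond -[1+ n ]) (flip-insertSecond -[1+ n ]) p ◅◅ (zero , refl) ◅ ε

flips⇒orbit : ∀ {a m} {x y : Vec ℤ (suc m)} → Star Flip x y → SameOrbit a (suc m) x y
flips⇒orbit = Star.gmap (λ x → x) λ { {x} (j , refl) → fwd (bySign zero (suc j) (s≤s z≤n) x) }

normalize : ∀ a {m} (x : Vec ℤ (suc m)) → Σ (Vec ℤ (suc m)) λ y →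
            NormalShape y × SameOrbit a (suc m) x y × absList y ↭ absList x
normalize a x with y@(h ∷ t) , p , _ ∷ s ← sort x with σ , e ← ⇝⇒permute p with h′ , ∣h′∣≡∣h∣ , q ← normalizeSigns h t =
  h′ ∷ Vec.map +_ us , (us , refl , subst (λ b → Sorted (b ∷ absList t)) (sym ∣h′∣≡∣h∣) s) ,
  subst (SameOrbit a _ x) e (fwd (byPerm σ x) ◅ ε) ◅◅ flips⇒orbit q ,
  ↭-trans (↭-reflexive (cong₂ _∷_ ∣h′∣≡∣h∣ (absList-map+ us)))
    (subst (λ z → absList z ↭ absList x) e (proj₁ (↭⇒≈ {x = permute σ x} {x} (permute-↭ σ x))))
  where us = Vec.map ∣_∣ t

-- Descent to a canonical tuple

ascending⇒positive : ∀ {n} (x : Vec ℤ n) → 0ℤ ℤ.< at x 0 → SortedFrom 0 x → ∀ j → j ℕ.< n → 0ℤ ℤ.< at x j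
ascending⇒positive x p s zero    _   = p
ascending⇒positive x p s (suc j) j<n =
  ℤP.<-≤-trans (ascending⇒positive x p s j (ℕP.<-trans (ℕP.n<1+n j) j<n)) (s j z≤n j<n)

0<i*j : ∀ {i j} → 0ℤ ℤ.< i → 0ℤ ℤ.< j → 0ℤ ℤ.< i ℤ.* j
0<i*j {+ suc _} {+ suc _} _ _ = ℤ.+<+ (s≤s z≤n)
0<i*j {+ zero} (ℤ.+<+ ())
0<i*j {+ suc _} {+ zero} _ (ℤ.+<+ ())

prodUpTo-positive : ∀ {n} (x : Vec ℤ n) m → (∀ j → j ℕ.< m → 0ℤ ℤ.< at x j) → 0ℤ ℤ.< prodUpTo x m
prodUpTo-positive x zero    pos = ℤ.+<+ (s≤s z≤n)
prodUpTo-positive x (suc m) pos =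
  0<i*j (prodUpTo-positive x m λ j j<m → pos j (ℕP.m<n⇒m<1+n j<m)) (pos m (ℕP.n<1+n m))

∣c-z∣<∣z∣ : ∀ {c z} → 0ℤ ℤ.< c → c ℤ.< + 2 ℤ.* z → ∣ c ℤ.- z ∣ ℕ.< ∣ z ∣
∣c-z∣<∣z∣ {+ c} {+ v} (ℤ.+<+ 0<c) lt rewrite ℤP.m-n≡m⊖n c v with ℕP.≤-total c v
... | inj₁ c≤v rewrite ℤP.⊖-≤ c≤v | ℤP.∣-i∣≡∣i∣ (+ (v ℕ.∸ c)) =
  ℕP.∸-monoʳ-< 0<c c≤v
... | inj₂ v≤c rewrite ℤP.⊖-≥ v≤c = ℕP.+-cancelʳ-< v (c ℕ.∸ v) v (subst₂ ℕ._<_ (sym (ℕP.m∸n+n≡m v≤c))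
  (cong (v ℕ.+_) (ℕP.+-identityʳ v)) (ℤP.drop‿+<+ (subst (+ c ℤ.<_) (sym (ℤP.pos-* 2 v)) lt)))
∣c-z∣<∣z∣ {+ c} { -[1+ v ]} (ℤ.+<+ _) ()

update-smaller : ∀ {n} (x : Vec ℤ (suc n)) i v → ∣ v ∣ ℕ.< ∣ lookup x i ∣ →
                 sum (absList (x [ i ]≔ v)) ℕ.< sum (absList x)
update-smaller x i v lt = subst₂ ℕ._<_ (sym (sum-↭ (absList-update x i v))) (sym (sum-↭ (proj₁ (state-lookup x i))))
  (ℕP.+-monoˡ-< (sum (absList (removeAt x i))) lt)

-- Only the size bound on the last coordinate can fail for a sorted tuple, and
-- then the Vieta move at that coordinate shrinks it.
canonical-or-smaller : ∀ A {m} → 0 ℕ.< A → (x : Vec ℤ (suc (suc m))) → NormalShape x →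
  Canonical (+ A) x ⊎ sum (absList (vieta (+ A) (Fin.fromℕ (suc m)) x)) ℕ.< sum (absList x)
canonical-or-smaller A 0<A (+ zero ∷ _) (us@(u ∷ _) , refl , b ∷ s) =
  inj₁ (inj₁ (refl , ℤ.+≤+ z≤n , SortedFrom-∷ (sorted⇒ascending us s)))
canonical-or-smaller A 0<A (-[1+ p ] ∷ _) (us@(u ∷ _) , refl , b ∷ s) =
  inj₁ (inj₂ (inj₁ (ℤ.+<+ (s≤s z≤n) , ℤ.+≤+ b , SortedFrom-∷ (sorted⇒ascending us s))))
canonical-or-smaller A {m} 0<A x@(+ suc p ∷ _) (us , refl , s)
  with + 2 ℤ.* at x (suc m) ℤ.≤? + A ℤ.* prodUpTo x (suc m)
... | yes bound = inj₁ (inj₂ (inj₂ (ℤ.+<+ (s≤s z≤n) , sorted⇒ascending (suc p ∷ us) s , bound)))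
... | no  large = inj₂ (update-smaller x (Fin.fromℕ (suc m)) _
  (subst₂ (λ q z → ∣ + A ℤ.* q ℤ.- z ∣ ℕ.< ∣ z ∣)
    (sym (trans (prodExcept≡ x (Fin.fromℕ (suc m))) (prodV-removeLast x))) (sym (lookup-last x))
    (∣c-z∣<∣z∣ 0<c (ℤP.≰⇒> large))))
  where
  0<P : 0ℤ ℤ.< prodUpTo x (suc m)
  0<P = prodUpTo-positive x (suc m) λ j j<m →
    ascending⇒positive x (ℤ.+<+ (s≤s z≤n)) (sorted⇒ascending (suc p ∷ us) s) j (ℕP.m<n⇒m<1+n j<m)
  0<c : 0ℤ ℤ.< + A ℤ.* prodUpTo x (suc m)
  0<c = 0<i*j (ℤ.+<+ 0<A) 0<P

-- Descent on the sum of absolute values: normalising preserves it, and if the result is not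
-- canonical, the Vieta move at the last coordinate decreases it.
canonical-exists : ∀ A {m} → 0 ℕ.< A → (x : Vec ℤ (suc (suc m))) → Acc ℕ._<_ (sum (absList x)) →
  Σ (Vec ℤ (suc (suc m))) λ y → Canonical (+ A) y × SameOrbit (+ A) (suc (suc m)) x y
canonical-exists A {m} 0<A x (acc rs) with y , sh , o , e ← normalize (+ A) x with canonical-or-smaller A 0<A y sh
... | inj₁ c = y , c , o
... | inj₂ lt with z , c , o′ ← canonical-exists A 0<A (vieta (+ A) (Fin.fromℕ (suc m)) y)
                     (rs (subst (sum (absList (vieta (+ A) (Fin.fromℕ (suc m)) y)) ℕ.<_) (sum-↭ e) lt)) =
  z , c , o ◅◅ fwd (byVieta (Fin.fromℕ (suc m)) y) ◅ o′

-- Canonical tuples and the four sets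

-1ℤ : ℤ
-1ℤ = ℤ.- 1ℤ

sumSqUpTo : ∀ {n} → Vec ℤ n → ℕ → ℤ
sumSqUpTo x zero    = 0ℤ
sumSqUpTo x (suc m) = sumSqUpTo x m ℤ.+ at x m ℤ.* at x m

sumSqUpTo-∷ : ∀ {n} h (t : Vec ℤ n) m → sumSqUpTo (h ∷ t) (suc m) ≡ h ℤ.* h ℤ.+ sumSqUpTo t m
sumSqUpTo-∷ h t zero    = ℤP.+-comm 0ℤ (h ℤ.* h)
sumSqUpTo-∷ h t (suc m) = trans (cong (λ s → s ℤ.+ at t m ℤ.* at t m) (sumSqUpTo-∷ h t m)) (ℤP.+-assoc (h ℤ.* h) _ _)

sumSq≡sumSqUpTo : ∀ {n} (x : Vec ℤ n) → sumSq x ≡ sumSqUpTo x n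
sumSq≡sumSqUpTo []      = refl
sumSq≡sumSqUpTo {suc n} (h ∷ t) = trans (cong (λ s → h ℤ.* h ℤ.+ s) (sumSq≡sumSqUpTo t)) (sym (sumSqUpTo-∷ h t n))

-- `e` is a sign ±1, so that positive and negative heads are treated together.
ones-prefix : ∀ {n} (x : Vec ℤ n) m {e} → at x 0 ≡ e → e ℤ.* e ≡ 1ℤ → OnesBetween 1 (suc m) x →
              prodUpTo x (suc m) ≡ e × sumSqUpTo x (suc m) ≡ + suc m
ones-prefix x zero    e≡ e² ones rewrite e≡ | e² = ℤP.*-identityˡ _ , refl
ones-prefix x (suc m) e≡ e² ones
  with p , s ← ones-prefix x m e≡ e² (λ j 1≤j j<m → ones j 1≤j (ℕP.m<n⇒m<1+n j<m))
  rewrite ones (suc m) (s≤s z≤n) (ℕP.n<1+n (suc m)) | p | s =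
  ℤP.*-identityʳ _ , cong +_ (ℕP.+-comm (suc m) 1)

-- The first r + 1 entries are (e, 1, …, 1, 2), read as (2e) for r = 0.
TwoPrefix : ∀ {n} → ℤ → Vec ℤ n → ℕ → Set
TwoPrefix e x zero    = at x 0 ≡ e ℤ.* + 2
TwoPrefix e x (suc q) = at x 0 ≡ e × OnesBetween 1 (suc q) x × at x (suc q) ≡ + 2

ones-two-prefix : ∀ {n} (x : Vec ℤ n) r → OnesBetween 0 r x → at x r ≡ + 2 → TwoPrefix 1ℤ x r
ones-two-prefix x zero    ones two = two
ones-two-prefix x (suc q) ones two = ones 0 z≤n (s≤s z≤n) , (λ j _ → ones j z≤n) , two

two-prefix : ∀ {n} (x : Vec ℤ n) r {e} → e ℤ.* e ≡ 1ℤ → TwoPrefix e x r →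
             prodUpTo x (suc r) ≡ e ℤ.* + 2 × sumSqUpTo x (suc r) ≡ + (4 ℕ.+ r)
two-prefix x zero {e} e² two rewrite two = ℤP.*-identityˡ _ , trans (solve e) (cong (ℤ._* + 4) e²)
  where
  solve : ∀ e → 0ℤ ℤ.+ e ℤ.* + 2 ℤ.* (e ℤ.* + 2) ≡ e ℤ.* e ℤ.* + 4
  solve = solve-∀
two-prefix x (suc q) e² (e≡ , ones , two) with p , s ← ones-prefix x q e≡ e² ones rewrite two | p | s =
  refl , cong +_ (ℕP.+-comm (suc q) 4)

-- `sumSqUpTo` and `prodUpTo` peel entries off on the right, so the last two coordinates split off
-- and the first n - 2 enter only through `P` and `S`.
F-split : ∀ a {r} (x : Vec ℤ (3 ℕ.+ r)) {P S} → let y = at x (1 ℕ.+ r); z = at x (2 ℕ.+ r) in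
          prodUpTo x (suc r) ≡ P → sumSqUpTo x (suc r) ≡ S →
          F a x ≡ (S ℤ.+ y ℤ.* y ℤ.+ z ℤ.* z) ℤ.- a ℤ.* (P ℤ.* y ℤ.* z)
F-split a x refl refl = cong₂ (λ s p → s ℤ.- a ℤ.* p) (sumSq≡sumSqUpTo x) (prodV≡prodUpTo x)

F-ones : ∀ {r} (x : Vec ℤ (3 ℕ.+ r)) → at x 0 ≡ -1ℤ → OnesBetween 1 (suc r) x →
         let y = at x (1 ℕ.+ r); z = at x (2 ℕ.+ r) in
         F 1ℤ x ≡ (y ℤ.* y ℤ.+ z ℤ.* z ℤ.+ y ℤ.* z) ℤ.+ (+ (3 ℕ.+ r) ℤ.- + 2)
F-ones {r} x h ones with p , s ← ones-prefix x r h refl ones =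
  trans (F-split 1ℤ x p s) (solve (+ r) (at x (1 ℕ.+ r)) (at x (2 ℕ.+ r)))
  where
  solve : ∀ R y z → (1ℤ ℤ.+ R ℤ.+ y ℤ.* y ℤ.+ z ℤ.* z) ℤ.- 1ℤ ℤ.* (-1ℤ ℤ.* y ℤ.* z)
                    ≡ (y ℤ.* y ℤ.+ z ℤ.* z ℤ.+ y ℤ.* z) ℤ.+ (+ 3 ℤ.+ R ℤ.- + 2)
  solve = solve-∀

-- Here a times the prefix product is -2, and y² + z² + 2yz is a perfect square.
F-ones₂ : ∀ {r} (x : Vec ℤ (3 ℕ.+ r)) → at x 0 ≡ -1ℤ → OnesBetween 1 (suc r) x →
          let y = at x (1 ℕ.+ r); z = at x (2 ℕ.+ r) in
          F (+ 2) x ≡ (y ℤ.+ z) ℤ.* (y ℤ.+ z) ℤ.+ (+ (3 ℕ.+ r) ℤ.- + 2)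
F-ones₂ {r} x h ones with p , s ← ones-prefix x r h refl ones =
  trans (F-split (+ 2) x p s) (solve (+ r) (at x (1 ℕ.+ r)) (at x (2 ℕ.+ r)))
  where
  solve : ∀ R y z → (1ℤ ℤ.+ R ℤ.+ y ℤ.* y ℤ.+ z ℤ.* z) ℤ.- + 2 ℤ.* (-1ℤ ℤ.* y ℤ.* z)
                    ≡ (y ℤ.+ z) ℤ.* (y ℤ.+ z) ℤ.+ (+ 3 ℤ.+ R ℤ.- + 2)
  solve = solve-∀

-- Again a times the prefix product is -2. The prefix has sum of squares n + 1, written n - (-1) to
-- fit `transpose→` and `transpose←`.
F-two : ∀ {r} (x : Vec ℤ (3 ℕ.+ r)) → TwoPrefix -1ℤ x r →
        let y = at x (1 ℕ.+ r); z = at x (2 ℕ.+ r) in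
        F 1ℤ x ≡ (y ℤ.+ z) ℤ.* (y ℤ.+ z) ℤ.+ (+ (3 ℕ.+ r) ℤ.- -1ℤ)
F-two {r} x two with p , s ← two-prefix x r refl two =
  trans (F-split 1ℤ x p s) (solve (+ r) (at x (1 ℕ.+ r)) (at x (2 ℕ.+ r)))
  where
  solve : ∀ R y z → (+ 4 ℤ.+ R ℤ.+ y ℤ.* y ℤ.+ z ℤ.* z) ℤ.- 1ℤ ℤ.* ((ℤ.- + 2) ℤ.* y ℤ.* z)
                    ≡ (y ℤ.+ z) ℤ.* (y ℤ.+ z) ℤ.+ (+ 3 ℤ.+ R ℤ.- -1ℤ)
  solve = solve-∀

-- With a times the prefix product equal to 2, the last two coordinates contribute (y - z)² = 0, and
-- only the n - 2 ones remain.
F-ones₂-equal : ∀ {r} (x : Vec ℤ (3 ℕ.+ r)) → at x 0 ≡ 1ℤ → OnesBetween 1 (suc r) x →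
                at x (2 ℕ.+ r) ≡ at x (1 ℕ.+ r) → F (+ 2) x ≡ + (3 ℕ.+ r) ℤ.- + 2
F-ones₂-equal {r} x h ones z≡y with p , s ← ones-prefix x r h refl ones =
  trans (F-split (+ 2) x p s)
    (trans (cong (λ z → (+ suc r ℤ.+ y ℤ.* y ℤ.+ z ℤ.* z) ℤ.- + 2 ℤ.* (1ℤ ℤ.* y ℤ.* z)) z≡y) (solve (+ r) y))
  where
  y = at x (1 ℕ.+ r)
  solve : ∀ R y → (1ℤ ℤ.+ R ℤ.+ y ℤ.* y ℤ.+ y ℤ.* y) ℤ.- + 2 ℤ.* (1ℤ ℤ.* y ℤ.* y) ≡ + 3 ℤ.+ R ℤ.- + 2
  solve = solve-∀

F-two-equal : ∀ {r} (x : Vec ℤ (3 ℕ.+ r)) → TwoPrefix 1ℤ x r →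
              at x (2 ℕ.+ r) ≡ at x (1 ℕ.+ r) → F 1ℤ x ≡ + (3 ℕ.+ r) ℤ.+ 1ℤ
F-two-equal {r} x two z≡y with p , s ← two-prefix x r refl two =
  trans (F-split 1ℤ x p s)
    (trans (cong (λ z → (+ (4 ℕ.+ r) ℤ.+ y ℤ.* y ℤ.+ z ℤ.* z) ℤ.- 1ℤ ℤ.* (+ 2 ℤ.* y ℤ.* z)) z≡y) (solve (+ r) y))
  where
  y = at x (1 ℕ.+ r)
  solve : ∀ R y → (+ 4 ℤ.+ R ℤ.+ y ℤ.* y ℤ.+ y ℤ.* y) ℤ.- 1ℤ ℤ.* (+ 2 ℤ.* y ℤ.* y) ≡ + 3 ℤ.+ R ℤ.+ 1ℤ
  solve = solve-∀

transpose→ : ∀ {L N k} c → L ≡ k ℤ.- N ℤ.+ c → L ℤ.+ (N ℤ.- c) ≡ k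
transpose→ {N = N} {k} c refl = solve k N c
  where
  solve : ∀ k N c → k ℤ.- N ℤ.+ c ℤ.+ (N ℤ.- c) ≡ k
  solve = solve-∀

transpose← : ∀ {L N k} c → L ℤ.+ (N ℤ.- c) ≡ k → L ≡ k ℤ.- N ℤ.+ c
transpose← {L} {N} c refl = solve L N c
  where
  solve : ∀ L N c → L ≡ L ℤ.+ (N ℤ.- c) ℤ.- N ℤ.+ c
  solve = solve-∀

-- `SortedFrom` with its end point freed from the length of the tuple, so that an ascending prefix
-- can be extended entry by entry.
Ascending : ∀ {n} → ℕ → ℕ → Vec ℤ n → Set
Ascending lo m x = ∀ j → lo ℕ.≤ j → suc j ℕ.< m → at x j ℤ.≤ at x (suc j)

ascending-suc : ∀ {n lo m} (x : Vec ℤ n) → Ascending lo (suc m) x → (lo ℕ.≤ m → at x m ℤ.≤ at x (suc m)) →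
                Ascending lo (suc (suc m)) x
ascending-suc {m = m} x asc last j lo≤j (s≤s j<) with ℕP.m≤n⇒m<n∨m≡n j<
... | inj₁ lt   = asc j lo≤j lt
... | inj₂ refl = last lo≤j

ones-ascending : ∀ {n lo m} (x : Vec ℤ n) → OnesBetween lo m x → Ascending lo m x
ones-ascending x ones j lo≤j j<m
  rewrite ones j lo≤j (ℕP.<-trans (ℕP.n<1+n j) j<m) | ones (suc j) (ℕP.m≤n⇒m≤1+n lo≤j) j<m = ℤP.≤-refl

1≤2 : 1ℤ ℤ.≤ + 2
1≤2 = ℤ.+≤+ (s≤s z≤n)

ones-sorted : ∀ {r lo} (x : Vec ℤ (3 ℕ.+ r)) → OnesBetween lo (suc r) x →
              1ℤ ℤ.≤ at x (1 ℕ.+ r) → at x (1 ℕ.+ r) ℤ.≤ at x (2 ℕ.+ r) → SortedFrom lo x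
ones-sorted {r} x ones 1≤y y≤z = ascending-suc x (ascending-suc x (ones-ascending x ones)
  (λ lo≤r → subst (ℤ._≤ at x (1 ℕ.+ r)) (sym (ones r lo≤r (ℕP.n<1+n r))) 1≤y)) (λ _ → y≤z)

two-sorted : ∀ {r lo} (x : Vec ℤ (3 ℕ.+ r)) → OnesBetween lo r x → (lo ℕ.≤ r → at x r ≡ + 2) →
             + 2 ℤ.≤ at x (1 ℕ.+ r) → at x (1 ℕ.+ r) ℤ.≤ at x (2 ℕ.+ r) → SortedFrom lo x
two-sorted {r} x ones two 2≤y y≤z = ascending-suc x (ascending-suc x (prefix r ones two)
  (λ lo≤r → subst (ℤ._≤ at x (1 ℕ.+ r)) (sym (two lo≤r)) 2≤y)) (λ _ → y≤z)
  where
  prefix : ∀ r → OnesBetween _ r x → (_ ℕ.≤ r → at x r ≡ + 2) → Ascending _ (suc r) x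
  prefix zero    _    _   j _ (s≤s ())
  prefix (suc q) ones two = ascending-suc x (ones-ascending x ones) λ lo≤q →
    subst₂ ℤ._≤_ (sym (ones q lo≤q (ℕP.n<1+n q))) (sym (two (ℕP.m≤n⇒m≤1+n lo≤q))) 1≤2

1≤second : ∀ {r} (x : Vec ℤ (3 ℕ.+ r)) → OnesBetween 1 (suc r) x → 1ℤ ℤ.≤ at x (1 ℕ.+ r) → 1ℤ ℤ.≤ at x 1
1≤second {zero}  x ones 1≤y = 1≤y
1≤second {suc r} x ones 1≤y = ℤP.≤-reflexive (sym (ones 1 (s≤s z≤n) (s≤s (s≤s z≤n))))

0<1 : 0ℤ ℤ.< 1ℤ
0<1 = ℤ.+<+ (s≤s z≤n)

canonical-negative : ∀ a {n} (x : Vec ℤ n) c → at x 0 ≡ ℤ.- + suc c → + suc c ℤ.≤ at x 1 → SortedFrom 1 x → Canonical a x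
canonical-negative a x c h b s = inj₂ (inj₁ (subst (λ i → 0ℤ ℤ.< ℤ.- i × ℤ.- i ℤ.≤ at x 1 × SortedFrom 1 x) (sym h)
  (ℤ.+<+ (s≤s z≤n) , b , s)))

𝔇⇒V×canonical : ∀ {a k r} (x : Vec ℤ (3 ℕ.+ r)) → 𝔇 a k (3 ℕ.+ r) x → V a k (3 ℕ.+ r) x × Canonical a x
𝔇⇒V×canonical {a} x@(_ ∷ t) (inj₁ (refl , b , s , e)) =
  trans (cong (λ q → sumSq x ℤ.- q) (ℤP.*-zeroʳ a)) (trans (ℤP.+-identityʳ _) e) , inj₁ (refl , b , s)
𝔇⇒V×canonical x (inj₂ (inj₁ (refl , h , ones , 1≤y , y≤z , e))) =
  trans (F-ones x h ones) (transpose→ (+ 2) e) ,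
  canonical-negative 1ℤ x 0 h (1≤second x ones 1≤y) (ones-sorted x ones 1≤y y≤z)
𝔇⇒V×canonical {r = r} x (inj₂ (inj₂ (inj₁ (inj₁ (refl , inj₁ (ones , two , z≡y , 2≤y , refl)))))) =
  F-two-equal x (ones-two-prefix x r ones two) z≡y ,
  inj₂ (inj₂ (0<head r ones two , two-sorted x ones (λ _ → two) 2≤y (ℤP.≤-reflexive (sym z≡y)) ,
    -- The first n - 2 entries have product 2, so the size bound reads 2z ≤ 2y and is attained.
    ℤP.≤-reflexive (trans (cong (+ 2 ℤ.*_) z≡y) (sym (trans (ℤP.*-identityˡ _)
      (cong (ℤ._* at x (1 ℕ.+ r)) (proj₁ (two-prefix x r refl (ones-two-prefix x r ones two)))))))))
  where
  0<head : ∀ r → OnesBetween 0 r x → at x r ≡ + 2 → 0ℤ ℤ.< at x 0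
  0<head zero    ones two = subst (0ℤ ℤ.<_) (sym two) (ℤ.+<+ (s≤s z≤n))
  0<head (suc q) ones two = subst (0ℤ ℤ.<_) (sym (ones 0 z≤n (s≤s z≤n))) 0<1
𝔇⇒V×canonical x (inj₂ (inj₂ (inj₁ (inj₁ (refl , inj₂ (inj₁ (refl , h) , 2≤y , y≤z , _ , e)))))) =
  trans (F-two x h) (transpose→ -1ℤ e) ,
  -- For n = 3 the prefix is the single entry -2, which is `- + suc 1`.
  canonical-negative 1ℤ x 1 h 2≤y (two-sorted x (λ { zero () ; (suc _) _ () }) (λ ()) 2≤y y≤z)
𝔇⇒V×canonical {r = zero} x (inj₂ (inj₂ (inj₁ (inj₁ (refl , inj₂ (inj₂ (s≤s (s≤s (s≤s ())) , _) , _))))))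
𝔇⇒V×canonical {r = suc q} x (inj₂ (inj₂ (inj₁ (inj₁ (refl , inj₂ (inj₂ (_ , h , ones , two) , 2≤y , y≤z , _ , e)))))) =
  trans (F-two x (h , ones , two)) (transpose→ -1ℤ e) ,
  canonical-negative 1ℤ x 0 h (second q ones two) (two-sorted x ones (λ _ → two) 2≤y y≤z)
  where
  second : ∀ q → OnesBetween 1 (suc q) x → at x (suc q) ≡ + 2 → 1ℤ ℤ.≤ at x 1
  second zero    ones two = subst (1ℤ ℤ.≤_) (sym two) 1≤2
  second (suc q) ones two = ℤP.≤-reflexive (sym (ones 1 (s≤s z≤n) (s≤s (s≤s z≤n))))
𝔇⇒V×canonical {r = r} x (inj₂ (inj₂ (inj₁ (inj₂ (refl , inj₁ (ones , z≡y , 1≤y , refl)))))) =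
  F-ones₂-equal x (ones 0 z≤n (s≤s z≤n)) (λ j _ → ones j z≤n) z≡y ,
  inj₂ (inj₂ (subst (0ℤ ℤ.<_) (sym (ones 0 z≤n (s≤s z≤n))) 0<1 ,
    ones-sorted x ones 1≤y (ℤP.≤-reflexive (sym z≡y)) ,
    ℤP.≤-reflexive (cong (+ 2 ℤ.*_) (trans z≡y (sym (trans
      (cong (ℤ._* at x (1 ℕ.+ r)) (proj₁ (ones-prefix x r (ones 0 z≤n (s≤s z≤n)) refl (λ j _ → ones j z≤n))))
      (ℤP.*-identityˡ _)))))))
𝔇⇒V×canonical x (inj₂ (inj₂ (inj₁ (inj₂ (refl , inj₂ (h , ones , 1≤y , y≤z , _ , e)))))) =
  trans (F-ones₂ x h ones) (transpose→ (+ 2) e) ,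
  canonical-negative (+ 2) x 0 h (1≤second x ones 1≤y) (ones-sorted x ones 1≤y y≤z)
𝔇⇒V×canonical x (inj₂ (inj₂ (inj₂ (inj₁ (v , 0<h , s , b , _))))) = v , inj₂ (inj₂ (0<h , s , b))
𝔇⇒V×canonical x (inj₂ (inj₂ (inj₂ (inj₂ (v , 0<-h , b , s , _))))) = v , inj₂ (inj₁ (0<-h , b , s))

-- Classification by a times the product of the first n - 2 entries

0<suc : ∀ {n} → 0ℤ ℤ.< + suc n
0<suc = ℤ.+<+ (s≤s z≤n)

m*n≡2 : ∀ m n → m ℕ.* n ≡ 2 → (m ≡ 1 × n ≡ 2) ⊎ (m ≡ 2 × n ≡ 1)
m*n≡2 1 n e = inj₁ (refl , trans (sym (ℕP.*-identityˡ n)) e)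
m*n≡2 2 n e = inj₂ (refl , ℕP.*-cancelˡ-≡ n 1 2 e)
m*n≡2 (suc (suc (suc m))) zero e = contradiction (trans (sym (ℕP.*-zeroʳ m)) e) λ ()
m*n≡2 (suc (suc (suc m))) (suc n) e = contradiction
  (ℕP.≤-trans (ℕP.m≤m*n (3 ℕ.+ m) (suc n)) (ℕP.≤-reflexive e)) λ { (s≤s (s≤s ())) }

i*j≡1 : ∀ {i j} → 0ℤ ℤ.< i → 0ℤ ℤ.< j → i ℤ.* j ≡ 1ℤ → i ≡ 1ℤ × j ≡ 1ℤ
i*j≡1 {+ m} {+ n} (ℤ.+<+ _) (ℤ.+<+ _) e =
  cong +_ (ℕP.m*n≡1⇒m≡1 m n e′) , cong +_ (ℕP.m*n≡1⇒n≡1 m n e′)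
  where e′ = ℤP.+-injective (trans (ℤP.pos-* m n) e)

i*j≡2 : ∀ {i j} → 0ℤ ℤ.< i → 0ℤ ℤ.< j → i ℤ.* j ≡ + 2 → (i ≡ 1ℤ × j ≡ + 2) ⊎ (i ≡ + 2 × j ≡ 1ℤ)
i*j≡2 {+ m} {+ n} (ℤ.+<+ _) (ℤ.+<+ _) e =
  Sum.map (λ { (p , q) → cong +_ p , cong +_ q }) (λ { (p , q) → cong +_ p , cong +_ q })
    (m*n≡2 m n (ℤP.+-injective (trans (ℤP.pos-* m n) e)))

Positive : ∀ {n} → ℕ → Vec ℤ n → Set
Positive m x = ∀ j → j ℕ.< m → 0ℤ ℤ.< at x j

positive-pred : ∀ {n m} {x : Vec ℤ n} → Positive (suc m) x → Positive m x
positive-pred pos j j<m = pos j (ℕP.m<n⇒m<1+n j<m)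

ascending-pred : ∀ {n lo m} {x : Vec ℤ n} → Ascending lo (suc m) x → Ascending lo m x
ascending-pred asc j lo≤j j<m = asc j lo≤j (ℕP.m<n⇒m<1+n j<m)

prodUpTo≡1 : ∀ {n} (x : Vec ℤ n) m → Positive m x → prodUpTo x m ≡ 1ℤ → OnesBetween 0 m x
prodUpTo≡1 x (suc m) pos e j _ (s≤s j≤m)
  with p , q ← i*j≡1 (prodUpTo-positive x m (positive-pred {x = x} pos)) (pos m (ℕP.n<1+n m)) e
  with ℕP.m≤n⇒m<n∨m≡n j≤m
... | inj₁ j<m  = prodUpTo≡1 x m (positive-pred {x = x} pos) p j z≤n j<m
... | inj₂ refl = q

-- Exactly one factor is 2 and the others are 1; were the 2 not in last place, ascending order would
-- put a 1 after a larger entry.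
prodUpTo≡2 : ∀ {n} (x : Vec ℤ n) m → Positive (suc m) x → Ascending 0 (suc m) x → prodUpTo x (suc m) ≡ + 2 →
             OnesBetween 0 m x × at x m ≡ + 2
prodUpTo≡2 x m pos asc e
  with i*j≡2 (prodUpTo-positive x m (positive-pred {x = x} pos)) (pos m (ℕP.n<1+n m)) e
... | inj₁ (p , q) = prodUpTo≡1 x m (positive-pred {x = x} pos) p , q
prodUpTo≡2 x zero    pos asc e | inj₂ (() , _)
prodUpTo≡2 x (suc m) pos asc e | inj₂ (p , q)
  with _ , two ← prodUpTo≡2 x m (positive-pred {x = x} pos) (ascending-pred {x = x} asc) p =
  contradiction (subst₂ ℤ._≤_ two q (asc m z≤n (ℕP.n<1+n (suc m)))) λ { (ℤ.+≤+ (s≤s ())) }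

-- The positive integer a x₁⋯xₙ₋₂, with n - 2 = r + 1: equal to 1, equal to 2 as 1 · 2 or as 2 · 1,
-- or above 2.
PrefixClass : ∀ {n} → ℤ → Vec ℤ n → ℕ → Set
PrefixClass a x r =
    (a ≡ 1ℤ × OnesBetween 0 (suc r) x)
  ⊎ (a ≡ 1ℤ × OnesBetween 0 r x × at x r ≡ + 2)
  ⊎ (a ≡ + 2 × OnesBetween 0 (suc r) x)
  ⊎ + 2 ℤ.< a ℤ.* prodUpTo x (suc r)

classify-prefix : ∀ {n} a (x : Vec ℤ n) r → 0ℤ ℤ.< a → Positive (suc r) x → Ascending 0 (suc r) x → PrefixClass a x r
classify-prefix a x r 0<a pos asc = go (a ℤ.* prodUpTo x (suc r)) refl (0<i*j 0<a 0<P)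
  where
  0<P = prodUpTo-positive x (suc r) pos
  go : ∀ c → a ℤ.* prodUpTo x (suc r) ≡ c → 0ℤ ℤ.< c → PrefixClass a x r
  go (+ 0) e (ℤ.+<+ ())
  go (+ 1) e _ with p , q ← i*j≡1 0<a 0<P e = inj₁ (p , prodUpTo≡1 x (suc r) pos q)
  go (+ 2) e _ with i*j≡2 0<a 0<P e
  ... | inj₁ (p , q) = inj₂ (inj₁ (p , prodUpTo≡2 x r pos asc q))
  ... | inj₂ (p , q) = inj₂ (inj₂ (inj₁ (p , prodUpTo≡1 x (suc r) pos q)))
  go (+ suc (suc (suc c))) e _ = inj₂ (inj₂ (inj₂ (subst (+ 2 ℤ.<_) (sym e) (ℤ.+<+ (s≤s (s≤s (s≤s z≤n)))))))

positive⇒𝔇 : ∀ {a k r} (x : Vec ℤ (3 ℕ.+ r)) → 0ℤ ℤ.< a → V a k (3 ℕ.+ r) x → 0ℤ ℤ.< at x 0 → SortedFrom 0 x →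
             + 2 ℤ.* at x (2 ℕ.+ r) ℤ.≤ a ℤ.* prodUpTo x (2 ℕ.+ r) → 𝔇 a k (3 ℕ.+ r) x
positive⇒𝔇 {a} {k} {r} x 0<a v 0<h s b =
  go (classify-prefix a x r 0<a
       (positive-pred {x = x} (positive-pred {x = x} pos)) (ascending-pred {x = x} (ascending-pred {x = x} s)))
  where
  y = at x (1 ℕ.+ r)
  z = at x (2 ℕ.+ r)
  pos : Positive (3 ℕ.+ r) x
  pos = ascending⇒positive x 0<h s
  y≤z : y ℤ.≤ z
  y≤z = s (suc r) z≤n (ℕP.n<1+n (2 ℕ.+ r))
  r≤y : at x r ℤ.≤ y
  r≤y = s r z≤n (ℕP.m<n⇒m<1+n (ℕP.n<1+n (suc r)))
  0<y : 0ℤ ℤ.< y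
  0<y = pos (suc r) (ℕP.m<n⇒m<1+n (ℕP.n<1+n (suc r)))
  -- In this case the size bound becomes 2z ≤ 2y, while sortedness gives y ≤ z.
  aP : a ℤ.* prodUpTo x (suc r) ≡ + 2 → z ≡ y
  aP e = ℤP.≤-antisym (ℤP.*-cancelˡ-≤-pos z y (+ 2) (subst (+ 2 ℤ.* z ℤ.≤_)
    (trans (sym (ℤP.*-assoc a (prodUpTo x (suc r)) y)) (cong (ℤ._* y) e)) b)) y≤z
  go : PrefixClass a x r → 𝔇 a k (3 ℕ.+ r) x
  -- The size bound would read 2z ≤ y, impossible for 0 < y ≤ z. So the value 1 occurs only with a
  -- negative head.
  go (inj₁ (refl , ones)) = contradiction
    (ℤP.<-≤-trans (double< 0<y y≤z) (subst (+ 2 ℤ.* z ℤ.≤_) (trans (ℤP.*-identityˡ _) (trans (cong (ℤ._* y)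
      (proj₁ (ones-prefix x r (ones 0 z≤n (s≤s z≤n)) refl λ j _ → ones j z≤n))) (ℤP.*-identityˡ y))) b))
    (ℤP.<-irrefl refl)
    where
    double< : ∀ {y z} → 0ℤ ℤ.< y → y ℤ.≤ z → y ℤ.< + 2 ℤ.* z
    double< {+ suc m} {+ n} _ (ℤ.+≤+ m≤n) = subst (+ suc m ℤ.<_) (ℤP.pos-* 2 n)
      (ℤ.+<+ (ℕP.≤-<-trans m≤n (ℕP.m<m+n n (ℕP.<-≤-trans (s≤s z≤n) (ℕP.≤-trans m≤n (ℕP.m≤m+n n 0))))))
    double< {+ zero} (ℤ.+<+ ())
  go (inj₂ (inj₁ (refl , ones , two))) = inj₂ (inj₂ (inj₁ (inj₁ (refl , inj₁ (ones , two , z≡y ,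
      subst (ℤ._≤ y) two r≤y , trans (sym v) (F-two-equal x (ones-two-prefix x r ones two) z≡y))))))
    where
    z≡y = aP (cong (1ℤ ℤ.*_) (proj₁ (two-prefix x r refl (ones-two-prefix x r ones two))))
  go (inj₂ (inj₂ (inj₁ (refl , ones)))) = inj₂ (inj₂ (inj₁ (inj₂ (refl , inj₁ (ones , z≡y ,
      subst (ℤ._≤ y) (ones r z≤n (ℕP.n<1+n r)) r≤y , trans (sym v) (F-ones₂-equal x h ones₁ z≡y))))))
    where
    h = ones 0 z≤n (s≤s z≤n)
    ones₁ : OnesBetween 1 (suc r) x
    ones₁ j _ = ones j z≤n
    z≡y = aP (cong (+ 2 ℤ.*_) (proj₁ (ones-prefix x r h refl ones₁)))
  go (inj₂ (inj₂ (inj₂ 2<aP))) = inj₂ (inj₂ (inj₂ (inj₁ (v , 0<h , s , b , 2<aP))))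

negative-two-prefix : ∀ {a k r} p (t : Vec ℤ (2 ℕ.+ r)) → OnesBetween 0 r (+ suc p ∷ t) → at (+ suc p ∷ t) r ≡ + 2 →
                      Prefix-1-2 a k (3 ℕ.+ r) (-[1+ p ] ∷ t) × TwoPrefix -1ℤ (-[1+ p ] ∷ t) r
negative-two-prefix {r = zero}  p t ones two = inj₁ (refl , cong ℤ.-_ two) , cong ℤ.-_ two
negative-two-prefix {r = suc q} p t ones two =
  inj₂ (s≤s (s≤s (s≤s (s≤s z≤n))) , h , ones₁ , two) , h , ones₁ , two
  where
  h = cong ℤ.-_ (ones 0 z≤n (s≤s z≤n))
  ones₁ : OnesBetween 1 (suc q) (-[1+ p ] ∷ t)
  ones₁ (suc j) _ = ones (suc j) z≤n

-- Replacing the head by its absolute value gives a positive ascending tuple `x⁺`, to which the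
-- classification applies; what it says about the head and the prefix product is then negated.
negative⇒𝔇 : ∀ {a k r} p (t : Vec ℤ (2 ℕ.+ r)) → let x = -[1+ p ] ∷ t in
             0ℤ ℤ.< a → V a k (3 ℕ.+ r) x → + suc p ℤ.≤ at x 1 → SortedFrom 1 x → 𝔇 a k (3 ℕ.+ r) x
negative⇒𝔇 {a} {k} {r} p t 0<a v b s = go (classify-prefix a x⁺ r 0<a
    (positive-pred {x = x⁺} (positive-pred {x = x⁺} (ascending⇒positive x⁺ 0<suc s⁺)))
    (ascending-pred {x = x⁺} (ascending-pred {x = x⁺} s⁺)))
  where
  x x⁺ : Vec ℤ (3 ℕ.+ r)
  x  = -[1+ p ] ∷ t
  x⁺ = + suc p ∷ t
  y = at x (1 ℕ.+ r)
  z = at x (2 ℕ.+ r)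
  s⁺ : SortedFrom 0 x⁺
  s⁺ zero    _ _   = b
  s⁺ (suc j) _ j<n = s (suc j) (s≤s z≤n) j<n
  r≤y : at x⁺ r ℤ.≤ y
  r≤y = s⁺ r z≤n (ℕP.m<n⇒m<1+n (ℕP.n<1+n (suc r)))
  y≤z : y ℤ.≤ z
  y≤z = s (suc r) (s≤s z≤n) (ℕP.n<1+n (2 ℕ.+ r))
  0≤y+z : ∀ {c} → + c ℤ.≤ y → 0ℤ ℤ.≤ y ℤ.+ z
  0≤y+z c≤y = ℤP.+-mono-≤ (ℤP.≤-trans (ℤ.+≤+ z≤n) c≤y) (ℤP.≤-trans (ℤ.+≤+ z≤n) (ℤP.≤-trans c≤y y≤z))
  tail-ones : ∀ {m} → OnesBetween 0 m x⁺ → OnesBetween 1 m x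
  tail-ones ones (suc j) _ = ones (suc j) z≤n
  head≡ : ∀ {c} → at x⁺ 0 ≡ + c → at x 0 ≡ ℤ.- + c
  head≡ e = cong ℤ.-_ e
  go : PrefixClass a x⁺ r → 𝔇 a k (3 ℕ.+ r) x
  go (inj₁ (refl , ones)) = inj₂ (inj₁ (refl , h , tail-ones ones , subst (ℤ._≤ y) (ones r z≤n (ℕP.n<1+n r)) r≤y ,
    y≤z , transpose← (+ 2) (trans (sym (F-ones x h (tail-ones ones))) v)))
    where h = head≡ (ones 0 z≤n (s≤s z≤n))
  go (inj₂ (inj₁ (refl , ones , two))) = inj₂ (inj₂ (inj₁ (inj₁ (refl , inj₂ (proj₁ prefix , 2≤y , y≤z , 0≤y+z 2≤y ,
    transpose← -1ℤ (trans (sym (F-two x (proj₂ prefix))) v))))))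
    where
    2≤y = subst (ℤ._≤ y) two r≤y
    prefix = negative-two-prefix {1ℤ} {k} p t ones two
  go (inj₂ (inj₂ (inj₁ (refl , ones)))) = inj₂ (inj₂ (inj₁ (inj₂ (refl , inj₂ (h , tail-ones ones , 1≤y , y≤z , 0≤y+z 1≤y ,
    transpose← (+ 2) (trans (sym (F-ones₂ x h (tail-ones ones))) v))))))
    where
    h = head≡ (ones 0 z≤n (s≤s z≤n))
    1≤y = subst (ℤ._≤ y) (ones r z≤n (ℕP.n<1+n r)) r≤y
  go (inj₂ (inj₂ (inj₂ 2<aP))) = inj₂ (inj₂ (inj₂ (inj₂ (v , 0<suc , b , s ,
    subst (ℤ._< ℤ.- + 2) (sym (trans (cong (a ℤ.*_) P≡) (sym (ℤP.neg-distribʳ-* a _)))) (ℤP.neg-mono-< 2<aP)))))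
    where
    P≡ : prodUpTo x (suc r) ≡ ℤ.- prodUpTo x⁺ (suc r)
    P≡ = trans (prodUpTo-∷ -[1+ p ] t r) (trans (sym (ℤP.neg-distribˡ-* (+ suc p) _)) (cong ℤ.-_ (sym (prodUpTo-∷ (+ suc p) t r))))

V×canonical⇒𝔇 : ∀ {a k r} (x : Vec ℤ (3 ℕ.+ r)) → 0ℤ ℤ.< a → V a k (3 ℕ.+ r) x → Canonical a x → 𝔇 a k (3 ℕ.+ r) x
V×canonical⇒𝔇 {a} x@(_ ∷ t) 0<a v (inj₁ (refl , b , s)) =
  inj₁ (refl , b , s , trans (sym (trans (cong (λ q → sumSq x ℤ.- q) (ℤP.*-zeroʳ a)) (ℤP.+-identityʳ _))) v)
V×canonical⇒𝔇 (-[1+ p ] ∷ t) 0<a v (inj₂ (inj₁ (_ , b , s))) = negative⇒𝔇 p t 0<a v b s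
V×canonical⇒𝔇 (+ zero ∷ t) 0<a v (inj₂ (inj₁ (ℤ.+<+ () , _)))
V×canonical⇒𝔇 x 0<a v (inj₂ (inj₂ (0<h , s , b))) = positive⇒𝔇 x 0<a v 0<h s b

-- Invariance of the form on orbits and the fundamental domain

orbit-F : ∀ {a n} {x y : Vec ℤ n} → SameOrbit a n x y → F a x ≡ F a y
orbit-F ε            = refl
orbit-F (fwd s ◅ ss) = trans (sym (step-V s)) (orbit-F ss)
orbit-F (bwd s ◅ ss) = trans (step-V s) (orbit-F ss)

theorem1p1 : (a k : ℤ) (n : ℕ) → 0ℤ < a → 3 ≤ n →
    ((x y : Vec ℤ n) → Step a n x y → V a k n x → V a k n y)
    × ((x : Vec ℤ n) → 𝔇 a k n x → V a k n x)
    × ((x : Vec ℤ n) → V a k n x → Σ (Vec ℤ n) (λ y → 𝔇 a k n y × SameOrbit a n x y))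
    × ((x y : Vec ℤ n) → 𝔇 a k n x → 𝔇 a k n y → SameOrbit a n x y → x ≡ y)
theorem1p1 (+ A) k (suc (suc (suc r))) 0<a@(ℤ.+<+ 0<A) (s≤s (s≤s (s≤s z≤n))) =
  (λ x y s v → trans (step-V s) v) ,
  (λ x d → proj₁ (𝔇⇒V×canonical x d)) ,
  (λ x v → let y , c , o = canonical-exists A 0<A x (<-wellFounded _) in
           y , V×canonical⇒𝔇 y 0<a (trans (sym (orbit-F o)) v) c , o) ,
  (λ x y d e → canonical-unique A 0<A x y (proj₂ (𝔇⇒V×canonical x d)) (proj₂ (𝔇⇒V×canonical y e)))
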